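{- Let $G=(V,E)$ be a finite simple undirected graph with $n=|V|$ and $m=|E|$, given by adjacency lists. The procedure $\mathrm{Recognize}$ described in the context is a certifying recognition algorithm for quasi-threshold graphs running in time $O(n+m)$. That is: (1) if the test $p(u)=p(v)$ never fails during the run, then $G$ is a quasi-threshold graph and the final parent assignment $p$ is a skeleton of $G$ (with the virtual root $r$ removed, nodes $v$ with $p(v)=r$ being the roots of the forest); (2) if the test $p(u)=p(v)$ fails at some point, then the procedure outputs four nodes of $V$ that induce a $P_4$ or a $C_4$ in $G$, so that $G$ is not a quasi-threshold graph; (3) the total running time, including the construction of the output, is $O(n+m)$.
   Context: A finite simple undirected graph is a quasi-threshold (trivially perfect) graph if it contains neither $P_4$ (the path on 4 nodes) nor $C_4$ (the cycle on 4 nodes) as an induced subgraph. Equivalently, it is the transitive closure of a rooted forest: there is a rooted forest on the node set $V$, called a skeleton of the graph, such that two distinct nodes are adjacent if and only if one of them is an ancestor of the other in the forest. $p(v)$ denotes the parent of $v$. Procedure $\mathrm{Recognize}$. Let $G'$ be obtained from $G$ by adding a new node $r$ adjacent to every node of $V$, and let $N(\cdot)$ and $d(\cdot)$ denote neighborhoods and degrees in $G'$. Initialize $p(u)=r$ for every $u\in V$, and regard $r$ as already processed. Sort $V$ once by decreasing degree (bucket sort) and process the nodes of $V$ in this order. To process $u$: for every neighbor $v$ of $u$ that has not been processed yet, test whether $p(u)=p(v)$; if the test succeeds, set $p(v):=u$. If the test fails, i.e. $p(u)\neq p(v)$, stop and do the following. If $p(v)$ was processed before $p(u)$, find a node $x\neq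 u$ that is a neighbor of $p(u)$ but not of $u$, and output the four nodes $v,u,p(u),x$. If $p(u)$ was processed before $p(v)$, proceed symmetrically with the roles of $u$ and $v$ exchanged: find $x\neq v$ that is a neighbor of $p(v)$ but not of $v$, and output $u,v,p(v),x$. If no test fails, output $p$ after all nodes have been processed. -}

module Defs where

open import Data.Bool.Base using (Bool; if_then_else_; _∨_; T)
open import Data.Bool.Properties using (∨-comm)
open import Data.Empty using (⊥)
open import Data.Fin.Base as Fin using (Fin; zero; suc; toℕ)
open import Data.Fin.Patterns using (0F; 1F; 2F; 3F)
import Data.Fin.Properties as Fin
open import Data.List.Base as List
  using (List; []; _∷_; _++_; _∷ʳ_; length; filter; allFin; cartesianProduct)
open import Data.List.Membership.Propositional using (_∈_)
import Data.List.Membership.DecPropositional as DecMembership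
open import Data.List.Relation.Binary.Permutation.Propositional using (_↭_)
open import Data.List.Relation.Unary.AllPairs using (AllPairs)
open import Data.List.Relation.Unary.Unique.Propositional using (Unique)
open import Data.Nat.Base using (ℕ; zero; suc; _+_; _∸_; _≤_; _≡ᵇ_; _<ᵇ_)
open import Data.Product.Base using (_×_; _,_; ∃-syntax; ∃₂)
open import Data.Sum.Base using (_⊎_)
open import Data.Unit.Base using (⊤; tt)
open import Data.Vec.Base as Vec using (Vec; []; _∷_; lookup)
open import Data.Vec.Functional using (Vector; updateAt)
import Data.Vec.Membership.Propositional as VecMembership
open import Function.Base using (const)
open import Function.Bundles using (_⇔_)
open import Function.Definitions using (Injective)
open import Relation.Binary.Construct.Closure.Transitive using (TransClosure)
open import Relation.Binary.PropositionalEquality.Core using (_≡_; _≢_; subst)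
open import Relation.Nullary.Decidable.Core using (Dec; yes; no; _×-dec_; T?)
open import Relation.Nullary.Negation.Core using (¬_)

------------------------------------------------------------------------
-- Graphs

record Graph (n : ℕ) : Set₁ where
  infix 4 _~_ _~?_
  field
    _~_      : Fin n → Fin n → Set
    _~?_     : ∀ u v → Dec (u ~ v)
    ~-sym    : ∀ {u v} → u ~ v → v ~ u
    ~-irrefl : ∀ {v} → ¬ (v ~ v)

open Graph public using () renaming (_~_ to Adj)

degree : ∀ {n} → Graph n → Fin n → ℕ
degree {n} G v = length (filter (v ~?_) (allFin n))
  where open Graph G

-- Each edge {u , v} is listed once, as the pair with u < v.
edges : ∀ {n} → Graph n → List (Fin n × Fin n)
edges {n} G =
  filter (λ (u , v) → (u Fin.<? v) ×-dec (u ~? v)) (cartesianProduct (allFin n) (allFin n))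
  where open Graph G

-- The list of u enumerates the neighbours of u, without repetition and in
-- arbitrary order.
record AdjacencyLists {n} (G : Graph n) : Set where
  field
    nbrs          : Fin n → List (Fin n)
    nbrs-sound    : ∀ {u v} → v ∈ nbrs u → Adj G u v
    nbrs-complete : ∀ {u v} → Adj G u v → v ∈ nbrs u
    nbrs-unique   : ∀ u → Unique (nbrs u)

-- The path 0 - 1 - 2 - 3.
P₄ : Graph 4
P₄ = record
  { _~_      = λ i j → T (adj i j)
  ; _~?_     = λ i j → T? (adj i j)
  ; ~-sym    = λ {i} {j} → subst T (∨-comm (toℕ j ≡ᵇ suc (toℕ i)) (toℕ i ≡ᵇ suc (toℕ j)))
  ; ~-irrefl = λ {i} → irr i
  }
  where
  adj : Fin 4 → Fin 4 → Bool
  adj i j = (toℕ j ≡ᵇ suc (toℕ i)) ∨ (toℕ i ≡ᵇ suc (toℕ j))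
  irr : ∀ i → ¬ T (adj i i)
  irr 0F ()
  irr 1F ()
  irr 2F ()
  irr 3F ()

-- The cycle 0 - 1 - 2 - 3 - 0.
C₄ : Graph 4
C₄ = record
  { _~_      = λ i j → T (adj i j)
  ; _~?_     = λ i j → T? (adj i j)
  ; ~-sym    = λ {i} {j} → subst T (∨-comm (toℕ j ≡ᵇ toℕ (next i)) (toℕ i ≡ᵇ toℕ (next j)))
  ; ~-irrefl = λ {i} → irr i
  }
  where
  next : Fin 4 → Fin 4
  next 0F = 1F
  next 1F = 2F
  next 2F = 3F
  next 3F = 0F
  adj : Fin 4 → Fin 4 → Bool
  adj i j = (toℕ j ≡ᵇ toℕ (next i)) ∨ (toℕ i ≡ᵇ toℕ (next j))
  irr : ∀ i → ¬ T (adj i i)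
  irr 0F ()
  irr 1F ()
  irr 2F ()
  irr 3F ()

record InducedCopy {k n} (H : Graph k) (G : Graph n) : Set where
  field
    embed     : Fin k → Fin n
    injective : Injective _≡_ _≡_ embed
    adj⇔adj   : ∀ i j → Adj H i j ⇔ Adj G (embed i) (embed j)

IsQuasiThreshold : ∀ {n} → Graph n → Set
IsQuasiThreshold G = ¬ InducedCopy P₄ G × ¬ InducedCopy C₄ G

-- The subgraph of G induced by the set of entries of q is isomorphic to H;
-- q may list the nodes in any order.
Induces : ∀ {n} → Graph n → Vec (Fin n) 4 → Graph 4 → Set
Induces G q H =
  ∃[ copy ] ∀ x → x VecMembership.∈ q ⇔ (∃[ i ] InducedCopy.embed {H = H} {G = G} copy i ≡ x)

------------------------------------------------------------------------
-- The graph G' and parent assignments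

-- A node of G' is the virtual root r or a node v of G, written suc v.
pattern r = zero

withRoot : ∀ {n} → Graph n → Graph (suc n)
withRoot {n} G = record
  { _~_      = _~′_
  ; _~?_     = _~′?_
  ; ~-sym    = λ {u} {v} → symm u v
  ; ~-irrefl = λ {v} → irr v
  }
  where
  open Graph G
  _~′_ : Fin (suc n) → Fin (suc n) → Set
  r     ~′ r     = ⊥
  r     ~′ suc v = ⊤
  suc u ~′ r     = ⊤
  suc u ~′ suc v = u ~ v
  _~′?_ : ∀ u v → Dec (u ~′ v)
  r     ~′? r     = no λ ()
  r     ~′? suc v = yes tt
  suc u ~′? r     = yes tt
  suc u ~′? suc v = u ~? v
  symm : ∀ u v → u ~′ v → v ~′ u
  symm r       (suc v) _ = tt
  symm (suc u) r       _ = tt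
  symm (suc u) (suc v) e = ~-sym e
  irr : ∀ v → ¬ (v ~′ v)
  irr (suc v) = ~-irrefl

Parents : ℕ → Set
Parents n = Vector (Fin (suc n)) n

ParentOf : ∀ {n} → Parents n → Fin n → Fin n → Set
ParentOf p v u = p v ≡ suc u

-- AncestorOf p v u: the node u is a proper ancestor of v.
AncestorOf : ∀ {n} → Parents n → Fin n → Fin n → Set
AncestorOf p = TransClosure (ParentOf p)

-- Removing r leaves a rooted forest whose roots are the v with p v ≡ r.  On a
-- finite node set this means that no node is its own proper ancestor.
IsRootedForest : ∀ {n} → Parents n → Set
IsRootedForest p = ∀ v → ¬ AncestorOf p v v

IsSkeleton : ∀ {n} → Graph n → Parents n → Set
IsSkeleton G p =
  IsRootedForest p ×
  (∀ u v → u ≢ v → Adj G u v ⇔ (AncestorOf p v u ⊎ AncestorOf p u v))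

------------------------------------------------------------------------
-- The procedure Recognize

-- Ties in degree may be broken in any way.
IsDecreasingDegreeOrder : ∀ {n} → Graph n → List (Fin n) → Set
IsDecreasingDegreeOrder {n} G order =
  order ↭ allFin n × AllPairs (λ u v → degree G′ (suc v) ≤ degree G′ (suc u)) order
  where G′ = withRoot G

-- The nodes processed so far, in chronological order.
Log : ℕ → Set
Log n = List (Fin (suc n))

ProcessedBefore : ∀ {n} → Log n → Fin (suc n) → Fin (suc n) → Set
ProcessedBefore log a b = ∃₂ λ xs ys → log ≡ xs ++ b ∷ ys × a ∈ xs

data Scan (n : ℕ) : Set where
  passed   : Parents n → Scan n
  failedAt : Parents n → Fin n → Scan n

data Outcome (n : ℕ) : Set where
  completed : Parents n → Outcome n
  -- The test p u ≡ p v failed while u was being processed.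
  failed    : Log n → Parents n → (u v : Fin n) → Outcome n

-- The neighbour r of u in G' is already processed, so only the neighbours of u
-- in G are scanned.
scan : ∀ {n} → Log n → Fin n → List (Fin n) → Parents n → Scan n
scan log u []       p = passed p
scan log u (v ∷ vs) p with DecMembership._∈?_ Fin._≟_ (suc v) log
... | yes _ = scan log u vs p
... | no  _ with p u Fin.≟ p v
...   | yes _ = scan log u vs (updateAt p v (const (suc u)))
...   | no  _ = failedAt p v

process : ∀ {n} → (Fin n → List (Fin n)) → List (Fin n) → Log n → Parents n → Outcome n
process nbrs []       log p = completed p
process nbrs (u ∷ us) log p with scan log u (nbrs u) p
... | passed p′     = process nbrs us (log ∷ʳ suc u) p′
... | failedAt p′ v = failed log p′ u v

recognize : ∀ {n} → (Fin n → List (Fin n)) → List (Fin n) → Outcome n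
recognize nbrs order = process nbrs order (r ∷ []) (const r)

data Finds {n} (G : Graph n) (log : Log n) (p : Parents n) (u v : Fin n) :
           Vec (Fin (suc n)) 4 → Set where
  finds : ∀ {x} → ProcessedBefore log (p v) (p u) →
          x ≢ suc u → Adj (withRoot G) (p u) x → ¬ Adj (withRoot G) (suc u) x →
          Finds G log p u v (suc v ∷ suc u ∷ p u ∷ x ∷ [])

-- The possible outputs after p u ≡ p v has failed; any suitable x may be found.
Outputs : ∀ {n} → Graph n → Log n → Parents n → (u v : Fin n) → Vec (Fin (suc n)) 4 → Set
Outputs G log p u v q = Finds G log p u v q ⊎ Finds G log p v u q

------------------------------------------------------------------------
-- A random access machine with unit costs

-- Registers and arrays are named by numbers.
record Store : Set where
  constructor store
  field
    reg : ℕ → ℕ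
    arr : ℕ → ℕ → ℕ

open Store public

infixl 9 _[_≔_]
_[_≔_] : {A : Set} → (ℕ → A) → ℕ → A → ℕ → A
(f [ k ≔ a ]) l = if l ≡ᵇ k then a else f l

infixl 6 _⊕_ _⊖_
infix  8 _⟪_⟫
data Expr : Set where
  lit     : ℕ → Expr
  !_      : ℕ → Expr
  _⟪_⟫    : ℕ → Expr → Expr
  _⊕_ _⊖_ : Expr → Expr → Expr

infix 5 _==_ _≺_
data Test : Set where
  _==_ _≺_ : Expr → Expr → Test

infixr 2 _⨾_
infixr 3 IF_THEN_ELSE_ FOR_<_DO_
infix  4 _≔_ _⟪_⟫≔_
data Cmd : Set where
  SKIP          : Cmd
  _≔_           : ℕ → Expr → Cmd
  _⟪_⟫≔_        : ℕ → Expr → Expr → Cmd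
  _⨾_           : Cmd → Cmd → Cmd
  IF_THEN_ELSE_ : Test → Cmd → Cmd → Cmd
  FOR_<_DO_     : ℕ → Expr → Cmd → Cmd

eval : Expr → Store → ℕ
eval (lit k)    s = k
eval (! x)      s = reg s x
eval (a ⟪ e ⟫)  s = arr s a (eval e s)
eval (e₁ ⊕ e₂)  s = eval e₁ s + eval e₂ s
eval (e₁ ⊖ e₂)  s = eval e₁ s ∸ eval e₂ s

test : Test → Store → Bool
test (e₁ == e₂) s = eval e₁ s ≡ᵇ eval e₂ s
test (e₁ ≺ e₂)  s = eval e₁ s <ᵇ eval e₂ s

setReg : ℕ → ℕ → Store → Store
setReg x k s = store (reg s [ x ≔ k ]) (arr s)

setArr : ℕ → ℕ → ℕ → Store → Store
setArr a l k s = store (reg s) (arr s [ a ≔ arr s a [ l ≔ k ] ])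

-- f 0, f 1, ..., f (k ∸ 1) in this order.
iterate : ℕ → (ℕ → Store → Store) → Store → Store
iterate zero    f s = s
iterate (suc k) f s = f k (iterate k f s)

-- The bound of a loop is evaluated once, before the first iteration.
exec : Cmd → Store → Store
exec SKIP                  s = s
exec (x ≔ e)               s = setReg x (eval e s) s
exec (a ⟪ l ⟫≔ e)          s = setArr a (eval l s) (eval e s) s
exec (c₁ ⨾ c₂)             s = exec c₂ (exec c₁ s)
exec (IF b THEN c₁ ELSE c₂) s = if test b s then exec c₁ s else exec c₂ s
exec (FOR x < e DO c)      s = iterate (eval e s) (λ k s′ → exec c (setReg x k s′)) s

-- Every constant, register access, array access, arithmetic operation,
-- comparison, assignment, branch and loop step takes one unit of time.
costE : Expr → ℕ
costE (lit k)   = 1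
costE (! x)     = 1
costE (a ⟪ e ⟫) = 1 + costE e
costE (e₁ ⊕ e₂) = 1 + costE e₁ + costE e₂
costE (e₁ ⊖ e₂) = 1 + costE e₁ + costE e₂

costT : Test → ℕ
costT (e₁ == e₂) = 1 + costE e₁ + costE e₂
costT (e₁ ≺ e₂)  = 1 + costE e₁ + costE e₂

iterateTime : ℕ → (ℕ → Store → Store) → (ℕ → Store → ℕ) → Store → ℕ
iterateTime zero    f t s = 0
iterateTime (suc k) f t s = iterateTime k f t s + (1 + t k (iterate k f s))

time : Cmd → Store → ℕ
time SKIP                   s = 1
time (x ≔ e)                s = 1 + costE e
time (a ⟪ l ⟫≔ e)           s = 1 + costE l + costE e
time (c₁ ⨾ c₂)              s = time c₁ s + time c₂ (exec c₁ s)
time (IF b THEN c₁ ELSE c₂) s = 1 + costT b + (if test b s then time c₁ s else time c₂ s)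
time (FOR x < e DO c)       s =
  1 + costE e +
  iterateTime (eval e s) (λ k s′ → exec c (setReg x k s′)) (λ k s′ → time c (setReg x k s′)) s

------------------------------------------------------------------------
-- Recognize as a program

module Registers where
  N I J K D U V W X Y FAILED : ℕ
  N = 0
  I = 1
  J = 2
  K = 3
  D = 4
  U = 5
  V = 6
  W = 7
  X = 8
  Y = 9
  FAILED = 10

module Arrays where
  START ADJ HEAD SIZE NEXT ORDER RANK PARENT MARK OUT : ℕ
  START  = 0
  ADJ    = 1
  HEAD   = 2
  SIZE   = 3
  NEXT   = 4
  ORDER  = 5
  RANK   = 6
  PARENT = 7
  MARK   = 8
  OUT    = 9

-- The machine represents a node of G' by its index, so r is 0 and the nodes of
-- V are 1, ..., n.
code : ∀ {n} → Fin (suc n) → ℕ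
code = toℕ

-- The adjacency lists are stored one after the other in ADJ; the list of u
-- occupies the addresses from START u up to, but excluding, START (u + 1).
-- Nothing is assumed about the other registers and arrays.
record Represents {n} (nbrs : Fin n → List (Fin n)) (s : Store) : Set where
  open Registers
  open Arrays
  field
    size     : reg s N ≡ n
    first    : arr s START 1 ≡ 0
    next     : ∀ u → arr s START (suc (code (suc u))) ≡
                     arr s START (code (suc u)) + length (nbrs u)
    contents : ∀ u (j : Fin (length (nbrs u))) →
               arr s ADJ (arr s START (code (suc u)) + toℕ j) ≡
               code (suc (List.lookup (nbrs u) j))

module Program where
  open Registers
  open Arrays

  -- The degree in G; degrees in G' are larger by one for every node of V.
  deg : Expr → Expr
  deg u = START ⟪ u ⊕ lit 1 ⟫ ⊖ START ⟪ u ⟫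

  -- The bucket of degree d is a linked list of SIZE d nodes starting with
  -- HEAD d.  Rank 0 belongs to r, rank k + 1 to ORDER k.
  bucketSort : Cmd
  bucketSort =
    FOR I < ! N DO
      ( HEAD ⟪ ! I ⟫≔ lit 0
      ⨾ SIZE ⟪ ! I ⟫≔ lit 0 )
    ⨾ FOR I < ! N DO
      ( U ≔ ! I ⊕ lit 1
      ⨾ D ≔ deg (! U)
      ⨾ NEXT ⟪ ! U ⟫≔ HEAD ⟪ ! D ⟫
      ⨾ HEAD ⟪ ! D ⟫≔ ! U
      ⨾ SIZE ⟪ ! D ⟫≔ SIZE ⟪ ! D ⟫ ⊕ lit 1 )
    ⨾ K ≔ lit 0
    ⨾ RANK ⟪ lit 0 ⟫≔ lit 0
    ⨾ FOR I < ! N DO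
      ( D ≔ ! N ⊖ (! I ⊕ lit 1)
      ⨾ U ≔ HEAD ⟪ ! D ⟫
      ⨾ FOR J < SIZE ⟪ ! D ⟫ DO
        ( ORDER ⟪ ! K ⟫≔ ! U
        ⨾ K ≔ ! K ⊕ lit 1
        ⨾ RANK ⟪ ! U ⟫≔ ! K
        ⨾ U ≔ NEXT ⟪ ! U ⟫ ) )

  -- While u is processed, a neighbour v of u is still unprocessed if and only
  -- if its rank exceeds the rank of u.
  test-neighbour : Cmd
  test-neighbour =
    V ≔ ADJ ⟪ START ⟪ ! U ⟫ ⊕ ! J ⟫
    ⨾ IF RANK ⟪ ! U ⟫ ≺ RANK ⟪ ! V ⟫
      THEN IF PARENT ⟪ ! U ⟫ == PARENT ⟪ ! V ⟫
        THEN PARENT ⟪ ! V ⟫≔ ! U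
        ELSE FAILED ≔ lit 1
      ELSE SKIP

  -- Once FAILED is set, the remaining iterations leave U, V and PARENT alone.
  processNodes : Cmd
  processNodes =
    FOR I < ! N DO (PARENT ⟪ ! I ⊕ lit 1 ⟫≔ lit 0)
    ⨾ FAILED ≔ lit 0
    ⨾ FOR I < ! N DO
      IF ! FAILED == lit 0
        THEN ( U ≔ ORDER ⟪ ! I ⟫
             ⨾ FOR J < deg (! U) DO
                 IF ! FAILED == lit 0 THEN test-neighbour ELSE SKIP )
        ELSE SKIP

  outputFour : Cmd
  outputFour =
    IF RANK ⟪ PARENT ⟪ ! V ⟫ ⟫ ≺ RANK ⟪ PARENT ⟪ ! U ⟫ ⟫
      THEN SKIP
      ELSE ( W ≔ ! U ⨾ U ≔ ! V ⨾ V ≔ ! W )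
    ⨾ W ≔ PARENT ⟪ ! U ⟫
    ⨾ FOR I < ! N DO (MARK ⟪ ! I ⊕ lit 1 ⟫≔ lit 0)
    ⨾ MARK ⟪ ! U ⟫≔ lit 1
    ⨾ FOR J < deg (! U) DO (MARK ⟪ ADJ ⟪ START ⟪ ! U ⟫ ⊕ ! J ⟫ ⟫≔ lit 1)
    ⨾ FOR J < deg (! W) DO
      ( Y ≔ ADJ ⟪ START ⟪ ! W ⟫ ⊕ ! J ⟫
      ⨾ IF MARK ⟪ ! Y ⟫ == lit 0 THEN X ≔ ! Y ELSE SKIP )
    ⨾ OUT ⟪ lit 0 ⟫≔ ! V
    ⨾ OUT ⟪ lit 1 ⟫≔ ! U
    ⨾ OUT ⟪ lit 2 ⟫≔ ! W
    ⨾ OUT ⟪ lit 3 ⟫≔ ! X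

  recognizeProgram : Cmd
  recognizeProgram =
    bucketSort
    ⨾ processNodes
    ⨾ IF ! FAILED == lit 0 THEN SKIP ELSE outputFour

open Program public using (recognizeProgram)

-- The final store s holds the result of the given outcome of Recognize: either
-- the parent assignment or one of the possible four-node outputs.
Reports : ∀ {n} → Graph n → Outcome n → Store → Set
Reports G (completed p) s =
  reg s FAILED ≡ 0 × (∀ v → arr s PARENT (code (suc v)) ≡ code (p v))
  where open Registers; open Arrays
Reports G (failed log p u v) s =
  reg s FAILED ≡ 1 ×
  ∃[ q ] Outputs G log p u v q × (∀ i → arr s OUT (toℕ i) ≡ code (lookup q i))
  where open Registers; open Arrays

module Submission where

-- After each step of the run, the processed neighbours of a node v are exactly
-- the ancestors of v under the current parent assignment; a successful test
-- p(u) = p(v) is what keeps this true when p(v) becomes u.  If no test fails, p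
-- is therefore a skeleton, and in a skeleton the two inner nodes of an induced P₄
-- or C₄ would be ancestors of each other.  If the test fails, p(u) and p(v) are
-- the last processed neighbours of u and v.  When p(v) is the earlier one, v is
-- not adjacent to p(u), and since d(u) ≤ d(p(u)) some neighbour x ≠ u of p(u)
-- is not adjacent to u; then v, u, p(u), x induce a P₄ or a C₄.
--
-- For the machine, every loop runs along a list (nodes, degrees, a bucket, an
-- adjacency list), so that one rule gives both its invariant and its cost as a
-- sum over that list.  The bucket sizes add up to n and the degrees to at most 2m.

open import Defs
open import Data.Fin.Base using (Fin; suc)
open import Data.List.Base using (List; length)
open import Data.Nat.Base using (ℕ; _+_; _*_; _≤_)
open import Data.Product.Base using (_×_; ∃-syntax)
open import Data.Sum.Base using (_⊎_)
open import Data.Vec.Base using (Vec; map)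
open import Relation.Binary.PropositionalEquality.Core using (_≡_)
open import Relation.Nullary.Negation.Core using (¬_)

open import Data.Bool.Base using (true; false; T)
open import Data.Empty using (⊥-elim)
open import Data.Fin.Base as Fin using (toℕ; zero)
open import Data.Fin.Patterns using (0F; 1F; 2F; 3F)
import Data.Fin.Properties as Fin
open import Data.List.Base as List
  using ( []; _∷_; _++_; _∷ʳ_; initLast; _∷ʳ′_; filter; allFin; concatMap; downFrom; tabulate )
import Data.List.Membership.DecPropositional as DecMembership
open import Data.List.Membership.Propositional using (_∈_; _∉_)
open import Data.List.Membership.Propositional.Properties
  using ( ∈-∃++; ∈-++⁺ˡ; ∈-++⁺ʳ; ∈-++⁻; ∈-insert; ∈-map⁺; ∈-map⁻; ∈-filter⁺; ∈-filter⁻; ∈-allFin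
        ; ∈-concatMap⁺; ∈-concatMap⁻; ∈-cartesianProduct⁺; ∈-downFrom⁺ )
open import Data.List.Membership.Propositional.Properties.WithK using (unique∧set⇒bag)
open import Data.List.Properties
  using ( ++-assoc; ++-identityʳ; ∷ʳ-injective; ∷-injective; length-++; length-map
        ; length-tabulate; map-++; concatMap-++; length-downFrom )
open import Data.List.Relation.Binary.BagAndSetEquality using (∼bag⇒↭)
open import Data.List.Relation.Binary.Disjoint.Propositional using (Disjoint)
open import Data.List.Relation.Binary.Permutation.Propositional using (_↭_; ↭-sym; ↭⇒↭ₛ)
open import Data.List.Relation.Binary.Permutation.Propositional.Properties
  using ( ∈-resp-↭; ↭-length; map⁺ )
import Data.List.Relation.Binary.Permutation.Setoid.Properties as PermSetoid
open import Data.List.Relation.Binary.Subset.Propositional using (_⊆_)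
open import Data.List.Relation.Unary.All as All using (All; []; _∷_)
import Data.List.Relation.Unary.All.Properties as All
open import Data.List.Relation.Unary.AllPairs as AllPairs using (AllPairs; []; _∷_)
import Data.List.Relation.Unary.AllPairs.Properties as AllPairs
open import Data.List.Relation.Unary.Any using (here; there)
import Data.List.Relation.Unary.Any as Any
open import Data.List.Relation.Unary.Unique.Propositional using (Unique)
import Data.List.Relation.Unary.Unique.Propositional.Properties as Unique
open import Data.Nat.Base using (zero; suc; _∸_; _<_; z≤n; s≤s; _≡ᵇ_; _<ᵇ_)
open import Data.Nat.ListAction using (sum)
open import Data.Nat.ListAction.Properties using (sum-++; sum-↭)
import Data.Nat.Properties as ℕ
open import Data.Nat.Solver using (module +-*-Solver)
open import Data.Product.Base as Product using (_,_; proj₁; proj₂; ∃₂)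
open import Data.Product.Properties using (,-injectiveˡ; ,-injectiveʳ)
open import Data.Sum.Base using (inj₁; inj₂; swap)
open import Data.Unit.Base using (⊤; tt)
open import Data.Vec.Base as Vec using ([]; _∷_; lookup)
open import Data.Vec.Functional using (updateAt)
open import Data.Vec.Functional.Properties using (updateAt-updates; updateAt-minimal)
open import Data.Vec.Membership.Propositional.Properties using (∈-lookup)
import Data.Vec.Relation.Unary.All as VecAll
import Data.Vec.Relation.Unary.AllPairs as VecAllPairs
import Data.Vec.Relation.Unary.Any as VecAny
open import Data.Vec.Relation.Unary.Any.Properties using (lookup-index)
open import Data.Vec.Relation.Unary.Unique.Propositional.Properties using (lookup-injective)
open import Function.Base using (_∘_; const; id)
open import Function.Bundles using (_⇔_; mk⇔; module Equivalence)
open import Relation.Binary.Construct.Closure.Transitive as Trans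
  using (_∷_) renaming ([_] to [_]⁺)
open import Relation.Binary.Definitions using (tri<; tri≈; tri>)
open import Relation.Binary.PropositionalEquality.Core
  using ( _≢_; refl; sym; trans; cong; cong₂; subst; subst₂; ≢-sym )
open import Relation.Binary.PropositionalEquality.Properties using (setoid; module ≡-Reasoning)
open import Relation.Nullary.Decidable.Core using (yes; no; _×-dec_; ¬?; decidable-stable)
open import Relation.Nullary.Negation.Core using (contradiction)

open Equivalence using (to; from)

-- The invariant speaks only of the moments between two scans, because in the middle of a scan of
-- `u` some neighbours already have the parent `u` and others do not yet. A failure, however,
-- happens in mid-scan. It can still be analysed because the two parents compared are those from the
-- start of the scan: `u` is not its own neighbour, and `v` occurs only once in the adjacency list.
--
-- The machine poses two further obstacles. It has no early exit: after a failure the loops run on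
-- idly, so the loop invariants get a second case in which the result is already fixed. And it
-- stores no log: both the test for processed nodes and the comparison of two parents use positions
-- in the complete order, which must be shown to agree with the log at that moment.
--
-- Predicates on stores unfold to statements about just the registers and arrays that they concern.
-- As these have literal numbers, a write elsewhere preserves them by computation, and the cost of a
-- straight-line body computes to a numeral.

private variable
  A : Set
  n : ℕ

-- Lists without repetition

unique-middle : ∀ xs {a : A} {ys} → Unique (xs ++ a ∷ ys) → a ∉ xs × a ∉ ys
unique-middle []       (a∉ ∷ _)  = (λ ()) , λ a∈ → All.lookup a∉ a∈ refl
unique-middle (x ∷ xs) (x∉ ∷ un) with a∉xs , a∉ys ← unique-middle xs un =
  (λ { (here refl) → All.lookup x∉ (∈-insert xs) refl ; (there a∈) → a∉xs a∈ }) , a∉ys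

-- `a` occurs only once, so it cannot lie inside the longer of two different prefixes. This gives
-- every node of a log a definite position.
split-unique : ∀ xs xs′ {a : A} {ys ys′} → Unique (xs ++ a ∷ ys) →
               xs ++ a ∷ ys ≡ xs′ ++ a ∷ ys′ → xs ≡ xs′ × ys ≡ ys′
split-unique []       []         un       refl = refl , refl
split-unique []       (_ ∷ xs′)  (a∉ ∷ _) refl = contradiction refl (All.lookup a∉ (∈-insert xs′))
split-unique (_ ∷ xs) []         (a∉ ∷ _) refl = contradiction refl (All.lookup a∉ (∈-insert xs))
split-unique (x ∷ xs) (x′ ∷ xs′) (_ ∷ un) eq with refl , eq′ ← ∷-injective eq
  with refl , refl ← split-unique xs xs′ un eq′ = refl , refl

-- Separates the newly appended node from the older ones; statements about all processed nodes are
-- extended along this distinction.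
split-∷ʳ : ∀ xs {u : A} ys {v zs} → xs ∷ʳ u ≡ ys ++ v ∷ zs →
           (ys ≡ xs × v ≡ u) ⊎ ∃[ zs′ ] xs ≡ ys ++ v ∷ zs′
split-∷ʳ xs ys {v} {zs} eq with initLast zs
... | []        with refl , refl ← ∷ʳ-injective xs ys eq = inj₁ (refl , refl)
... | zs′ ∷ʳ′ _
  with refl , _ ← ∷ʳ-injective xs (ys ++ v ∷ zs′) (trans eq (sym (++-assoc ys (v ∷ zs′) _))) =
  inj₂ (zs′ , refl)

unique-prefix : ∀ xs {ys : List A} → Unique (xs ++ ys) → Unique xs
unique-prefix []       _         = []
unique-prefix (x ∷ xs) (x∉ ∷ un) = All.++⁻ˡ xs x∉ ∷ unique-prefix xs un

all-pairs-++ : ∀ {R : A → A → Set} {xs ys x y} → AllPairs R (xs ++ ys) → x ∈ xs → y ∈ ys → R x y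
all-pairs-++ (Rx ∷ _)  (here refl) y∈ = All.lookup Rx (∈-++⁺ʳ _ y∈)
all-pairs-++ (_ ∷ Rxs) (there x∈)  y∈ = all-pairs-++ Rxs x∈ y∈

-- Pigeonhole: each head is cut out of `ys`, and no later entry falls on the removed place. Degrees,
-- nodes and arcs are all counted through such inclusions.
unique-⊆⇒length≤ : ∀ {xs ys : List A} → Unique xs → xs ⊆ ys → length xs ≤ length ys
unique-⊆⇒length≤ {xs = []}     _         _  = z≤n
unique-⊆⇒length≤ {xs = x ∷ xs} (x∉ ∷ un) xs⊆ys with ∈-∃++ (xs⊆ys (here refl))
... | as , bs , refl = ℕ.≤-trans (s≤s (unique-⊆⇒length≤ un xs⊆as++bs)) (ℕ.≤-reflexive (begin
    suc (length (as ++ bs))         ≡⟨ cong suc (length-++ as) ⟩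
    suc (length as + length bs)     ≡⟨ ℕ.+-suc (length as) (length bs) ⟨
    length as + suc (length bs)     ≡⟨ length-++ as ⟨
    length (as ++ x ∷ bs)           ∎))
  where
  open ≡-Reasoning
  xs⊆as++bs : xs ⊆ as ++ bs
  xs⊆as++bs y∈xs with ∈-++⁻ as (xs⊆ys (there y∈xs))
  ... | inj₁ y∈as         = ∈-++⁺ˡ y∈as
  ... | inj₂ (here refl)  = contradiction refl (All.lookup x∉ y∈xs)
  ... | inj₂ (there y∈bs) = ∈-++⁺ʳ as y∈bs

module _ (G : Graph n) (u : Fin n) where
  open Graph G

  -- `degree G u` unfolds to the length of this list, so inequalities of degrees are inequalities of
  -- list lengths.
  neighbours : List (Fin n)
  neighbours = filter (u ~?_) (allFin n)

  ∈-neighbours⁺ : ∀ {v} → u ~ v → v ∈ neighbours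
  ∈-neighbours⁺ = ∈-filter⁺ (u ~?_) (∈-allFin _)

  ∈-neighbours⁻ : ∀ {v} → v ∈ neighbours → u ~ v
  ∈-neighbours⁻ = proj₂ ∘ ∈-filter⁻ (u ~?_) {xs = allFin n}

  neighbours-unique : Unique neighbours
  neighbours-unique = Unique.filter⁺ (u ~?_) (Unique.allFin⁺ n)

-- Induced paths and cycles

-- Symmetry and irreflexivity settle the other pairs, which leaves six of sixteen for a graph on
-- four nodes.
adjacent⇔ : ∀ {k n} {H : Graph k} {G : Graph n} (f : Fin k → Fin n) →
            (∀ i j → i Fin.< j → Adj H i j ⇔ Adj G (f i) (f j)) →
            ∀ i j → Adj H i j ⇔ Adj G (f i) (f j)
adjacent⇔ {H = H} {G} f up i j with Fin.<-cmp i j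
... | tri< i<j _ _  = up i j i<j
... | tri≈ _ refl _ = mk⇔ (⊥-elim ∘ Graph.~-irrefl H) (⊥-elim ∘ Graph.~-irrefl G)
... | tri> _ _ j<i  =
  mk⇔ (Graph.~-sym G ∘ to (up j i j<i) ∘ Graph.~-sym H)
    (Graph.~-sym H ∘ from (up j i j<i) ∘ Graph.~-sym G)

module _ (G : Graph n) where
  open Graph G

  module _ {a b c d : Fin n} (a~b : a ~ b) (b~c : b ~ c) (c~d : c ~ d)
           (a≢c : a ≢ c) (b≢d : b ≢ d) (a≁c : ¬ a ~ c) (b≁d : ¬ b ~ d) where

    private
      nodes : Vec (Fin n) 4
      nodes = a ∷ b ∷ c ∷ d ∷ []

      ~⇒≢ : ∀ {x y} → x ~ y → x ≢ y
      ~⇒≢ x~y refl = ~-irrefl x~y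

      distinct : VecAllPairs.AllPairs _≢_ nodes
      distinct =
        -- `a` and `d` differ because `b` is adjacent to `a` but not to `d`.
        (~⇒≢ a~b ∷ a≢c ∷ (λ { refl → b≁d (~-sym a~b) }) ∷ []) ∷
        (~⇒≢ b~c ∷ b≢d ∷ []) ∷ (~⇒≢ c~d ∷ []) ∷ [] ∷ []
        where
        open VecAll using ([]; _∷_)
        open VecAllPairs using ([]; _∷_)

      induces : (H : Graph 4) →
                (∀ i j → i Fin.< j → Adj H i j ⇔ Adj G (lookup nodes i) (lookup nodes j)) →
                Induces G nodes H
      induces H up = record
        { embed     = lookup nodes
        ; injective = λ {i} {j} → lookup-injective distinct i j
        ; adj⇔adj   = adjacent⇔ {H = H} {G = G} (lookup nodes) up
        } , λ x → mk⇔ (λ x∈ → VecAny.index x∈ , sym (lookup-index x∈))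
                      λ { (i , refl) → ∈-lookup i nodes }

      both : ∀ {P Q : Set} → P → Q → P ⇔ Q
      both p q = mk⇔ (const q) (const p)

      neither : ∀ {P Q : Set} → ¬ P → ¬ Q → P ⇔ Q
      neither ¬p ¬q = mk⇔ (⊥-elim ∘ ¬p) (⊥-elim ∘ ¬q)

    -- The hypotheses leave only the pair `a`, `d` open; it decides whether the path closes to a
    -- cycle.
    induces-P₄⊎C₄ : Induces G nodes P₄ ⊎ Induces G nodes C₄
    induces-P₄⊎C₄ with a ~? d
    ... | no a≁d  = inj₁ (induces P₄ λ
      { 0F 1F _ → both tt a~b ; 0F 2F _ → neither (λ ()) a≁c ; 0F 3F _ → neither (λ ()) a≁d
      ; 1F 2F _ → both tt b~c ; 1F 3F _ → neither (λ ()) b≁d ; 2F 3F _ → both tt c~d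
      ; 1F 1F (s≤s ()) ; 2F 1F (s≤s ()) ; 2F 2F (s≤s (s≤s ()))
      ; 3F 1F (s≤s ()) ; 3F 2F (s≤s (s≤s ())) ; 3F 3F (s≤s (s≤s (s≤s ()))) })
    ... | yes a~d = inj₂ (induces C₄ λ
      { 0F 1F _ → both tt a~b ; 0F 2F _ → neither (λ ()) a≁c ; 0F 3F _ → both tt a~d
      ; 1F 2F _ → both tt b~c ; 1F 3F _ → neither (λ ()) b≁d ; 2F 3F _ → both tt c~d
      ; 1F 1F (s≤s ()) ; 2F 1F (s≤s ()) ; 2F 2F (s≤s (s≤s ()))
      ; 3F 1F (s≤s ()) ; 3F 2F (s≤s (s≤s ())) ; 3F 3F (s≤s (s≤s (s≤s ()))) })

  -- A node adjacent to two nonadjacent nodes is an ancestor of both, so the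
  -- two inner nodes of an induced P₄ or C₄ would be ancestors of each other.
  module _ {p : Parents n} (skeleton : IsSkeleton G p) where

    private
      forest : IsRootedForest p
      forest = proj₁ skeleton

      adj : ∀ u v → u ≢ v → u ~ v ⇔ (AncestorOf p v u ⊎ AncestorOf p u v)
      adj = proj₂ skeleton

      -- Both chains of parents start at `v`, and each node has a single parent, so they run
      -- together until the shorter one ends.
      ancestors-comparable : ∀ {v x y} → AncestorOf p v x → AncestorOf p v y →
                             x ≡ y ⊎ (AncestorOf p x y ⊎ AncestorOf p y x)
      ancestors-comparable [ e ]⁺   [ e′ ]⁺    with refl ← trans (sym e) e′ = inj₁ refl
      ancestors-comparable [ e ]⁺   (e′ ∷ ys) with refl ← trans (sym e) e′ = inj₂ (inj₁ ys)
      ancestors-comparable (e ∷ xs) [ e′ ]⁺   with refl ← trans (sym e) e′ = inj₂ (inj₂ xs)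
      ancestors-comparable (e ∷ xs) (e′ ∷ ys) with refl ← trans (sym e) e′ = ancestors-comparable xs ys

      comparable : ∀ {u v} → u ~ v → AncestorOf p v u ⊎ AncestorOf p u v
      comparable {u} {v} u~v = to (adj u v λ { refl → ~-irrefl u~v }) u~v

      incomparable : ∀ {u v} → u ≢ v → ¬ u ~ v → ¬ (AncestorOf p v u ⊎ AncestorOf p u v)
      incomparable {u} {v} u≢v u≁v = u≁v ∘ from (adj u v u≢v)

      middle : ∀ {a b c} → a ~ b → b ~ c → a ≢ c → ¬ a ~ c → AncestorOf p c b
      middle a~b b~c a≢c a≁c with comparable b~c | comparable a~b
      ... | inj₁ c<b | _        = c<b
      ... | inj₂ b<c | inj₂ a<b = contradiction (inj₂ (a<b Trans.++ b<c)) (incomparable a≢c a≁c)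
      ... | inj₂ b<c | inj₁ b<a with ancestors-comparable b<a b<c
      ...   | inj₁ a≡c = contradiction a≡c a≢c
      ...   | inj₂ ac  = contradiction (swap ac) (incomparable a≢c a≁c)

      no-four : ∀ {a b c d} → a ~ b → b ~ c → c ~ d → a ≢ c → b ≢ d → ¬ a ~ c → ¬ ¬ b ~ d
      no-four a~b b~c c~d a≢c b≢d a≁c b≁d =
        forest _ (middle a~b b~c a≢c a≁c Trans.++ middle (~-sym c~d) (~-sym b~c) (≢-sym b≢d)
          (b≁d ∘ ~-sym))

      -- These five conditions are common to `P₄` and `C₄`, which differ only in the pair `0F`,
      -- `3F`; one argument thus serves both.
      no-copy : (H : Graph 4) → Adj H 0F 1F → Adj H 1F 2F → Adj H 2F 3F →
                ¬ Adj H 0F 2F → ¬ Adj H 1F 3F → ¬ InducedCopy H G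
      no-copy H e₀₁ e₁₂ e₂₃ ē₀₂ ē₁₃ copy =
        no-four (to (adj⇔adj 0F 1F) e₀₁) (to (adj⇔adj 1F 2F) e₁₂) (to (adj⇔adj 2F 3F) e₂₃)
          ((λ ()) ∘ injective) ((λ ()) ∘ injective) (ē₀₂ ∘ from (adj⇔adj 0F 2F))
            (ē₁₃ ∘ from (adj⇔adj 1F 3F))
        where open InducedCopy copy

    skeleton⇒quasi-threshold : IsQuasiThreshold G
    skeleton⇒quasi-threshold = no-copy P₄ tt tt tt (λ ()) (λ ()) , no-copy C₄ tt tt tt (λ ()) (λ ())

-- Parent assignments during the run

log : List (Fin n) → Log n
log done = r ∷ List.map suc done

log-∷ʳ : ∀ (done : List (Fin n)) u → log done ∷ʳ suc u ≡ log (done ∷ʳ u)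
log-∷ʳ done u = cong (r ∷_) (sym (map-++ suc done (u ∷ [])))

suc∈log⁺ : ∀ {done} {v : Fin n} → v ∈ done → suc v ∈ log done
suc∈log⁺ = there ∘ ∈-map⁺ suc

suc∈log⁻ : ∀ {done} {v : Fin n} → suc v ∈ log done → v ∈ done
suc∈log⁻ (there v∈) with _ , v∈done , refl ← ∈-map⁻ suc v∈ = v∈done

log-⊆ : ∀ {xs ys : List (Fin n)} → xs ⊆ ys → log xs ⊆ log ys
log-⊆ xs⊆ys {r}     _  = here refl
log-⊆ xs⊆ys {suc v} v∈ = suc∈log⁺ (xs⊆ys (suc∈log⁻ v∈))

log-unique : ∀ {done : List (Fin n)} → Unique done → Unique (log done)
log-unique un = All.map⁺ (All.universal (λ _ ()) _) ∷ Unique.map⁺ Fin.suc-injective un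

Closed : Parents n → List (Fin n) → Set
Closed p done = ∀ {v} → v ∈ done → p v ∈ log done

ancestor∈ : ∀ {p} {done : List (Fin n)} → Closed p done →
            ∀ {v w} → p v ∈ log done → AncestorOf p v w → w ∈ done
ancestor∈ {done = done} closed pv∈ [ e ]⁺    = suc∈log⁻ (subst (_∈ log done) e pv∈)
ancestor∈ {done = done} closed pv∈ (e ∷ es) =
  ancestor∈ closed (closed (suc∈log⁻ (subst (_∈ log done) e pv∈))) es

-- A closed list confines the chain, so agreement on it and at `v` suffices. A scan changes parents
-- of unprocessed nodes only, hence known ancestor relations survive it.
ancestor-cong : ∀ {p q} {done : List (Fin n)} → Closed p done → (∀ {x} → x ∈ done → p x ≡ q x) →
                ∀ {v w} → p v ∈ log done → p v ≡ q v → AncestorOf p v w → AncestorOf q v w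
ancestor-cong closed p≗q pv∈ pv≡qv [ e ]⁺    = [ trans (sym pv≡qv) e ]⁺
ancestor-cong {done = done} closed p≗q pv∈ pv≡qv (e ∷ es) =
  trans (sym pv≡qv) e ∷ ancestor-cong closed p≗q (closed x∈) (p≗q x∈) es
  where x∈ = suc∈log⁻ (subst (_∈ log done) e pv∈)

ancestor-via : ∀ {p q : Parents n} {v u w} → p v ≡ p u → AncestorOf p v w → AncestorOf p u w
ancestor-via pv≡pu [ e ]⁺    = [ trans (sym pv≡pu) e ]⁺
ancestor-via pv≡pu (e ∷ es) = trans (sym pv≡pu) e ∷ es

-- The invariant between two scans

module _ (G : Graph n) where
  open Graph G

  record Placed (p : Parents n) (earlier : List (Fin n)) (v : Fin n) : Set where
    field
      parent∈      : p v ∈ log earlier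
      adj⇔ancestor : ∀ {w} → w ∈ earlier → v ~ w ⇔ AncestorOf p v w

  open Placed

  -- A waiting node is compared with all of `done`. A processed node is compared only with the nodes
  -- before it: its parent is final, its ancestors precede it, and its later neighbours are
  -- accounted for on their own side.
  record Consistent (done : List (Fin n)) (p : Parents n) : Set where
    field
      waiting   : ∀ {v} → v ∉ done → Placed p done v
      processed : ∀ {earlier v later} → done ≡ earlier ++ v ∷ later → Placed p earlier v

    closed : Closed p done
    closed v∈ with _ , _ , refl ← ∈-∃++ v∈ = log-⊆ ∈-++⁺ˡ (parent∈ (processed refl))

    -- Each `processed` statement is carried to a new assignment within its own prefix, which calls
    -- for closure of every prefix and not only of `done`.
    closed-earlier : ∀ {earlier later} → done ≡ earlier ++ later → Closed p earlier
    closed-earlier {earlier} refl v∈ with xs , ys , refl ← ∈-∃++ v∈ =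
      log-⊆ ∈-++⁺ˡ (parent∈ (processed (++-assoc xs (_ ∷ ys) _)))

  open Consistent

  consistent-[] : Consistent [] (const r)
  consistent-[] = record
    { waiting   = λ _ → record { parent∈ = here refl ; adj⇔ancestor = λ () }
    ; processed = λ { {[]} () ; {_ ∷ _} () }
    }

  -- The net effect of a scan of `u` that passes. It is phrased with the initial `p` alone, so the
  -- order of the adjacency list leaves no trace.
  record Updates (done : List (Fin n)) (u : Fin n) (p q : Parents n) : Set where
    field
      updated   : ∀ {v} → v ∉ done → u ~ v → p v ≡ p u × q v ≡ suc u
      unchanged : ∀ {v} → v ∈ done ⊎ ¬ u ~ v → p v ≡ q v

  -- The ancestors of an updated node v become u and the ancestors of u, which
  -- are the previous ancestors of v because p v ≡ p u.
  consistent-∷ʳ : ∀ {done u p q} → u ∉ done → Consistent done p → Updates done u p q →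
                  Consistent (done ∷ʳ u) q
  consistent-∷ʳ {done} {u} {p} {q} u∉ con upd = record { waiting = waiting′ ; processed = processed′ }
    where
    open Updates upd

    keep : ∀ {earlier later} → done ≡ earlier ++ later → ∀ {v} → p v ≡ q v →
           Placed p earlier v → Placed q earlier v
    keep {earlier} refl {v} pv≡qv pl = record
      { parent∈      = subst (_∈ log earlier) pv≡qv (parent∈ pl)
      ; adj⇔ancestor = λ w∈ → mk⇔
          (ancestor-cong cl agree (parent∈ pl) pv≡qv ∘ to (adj⇔ancestor pl w∈))
          (from (adj⇔ancestor pl w∈) ∘
           ancestor-cong (λ x∈ → subst (_∈ log earlier) (agree x∈) (cl x∈)) (sym ∘ agree)
             (subst (_∈ log earlier) pv≡qv (parent∈ pl)) (sym pv≡qv))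
      }
      where
      cl : Closed p earlier
      cl = closed-earlier con refl
      agree : ∀ {x} → x ∈ earlier → p x ≡ q x
      agree x∈ = unchanged (inj₁ (∈-++⁺ˡ x∈))

    keep-done : ∀ {v} → p v ≡ q v → Placed p done v → Placed q done v
    keep-done = keep (sym (++-identityʳ done))

    closed-q : Closed q done
    closed-q x∈ = subst (_∈ log done) (unchanged (inj₁ x∈)) (closed con x∈)

    placed-u : Placed q done u
    placed-u = keep-done (unchanged (inj₂ ~-irrefl)) (waiting con u∉)

    processed′ : ∀ {earlier v later} → done ∷ʳ u ≡ earlier ++ v ∷ later → Placed q earlier v
    processed′ {earlier} eq with split-∷ʳ done earlier eq
    ... | inj₁ (refl , refl)   = placed-u
    ... | inj₂ (later′ , refl) = keep refl (unchanged (inj₁ (∈-insert earlier))) (processed con refl)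

    waiting′ : ∀ {v} → v ∉ done ∷ʳ u → Placed q (done ∷ʳ u) v
    waiting′ {v} v∉ with u ~? v
    ... | yes u~v with pv≡pu , qv≡u ← updated (v∉ ∘ ∈-++⁺ˡ) u~v = record
      { parent∈      = subst (_∈ log (done ∷ʳ u)) (sym qv≡u) (suc∈log⁺ (∈-insert done))
      ; adj⇔ancestor = λ w∈ → adj⇔ w∈ (∈-++⁻ done w∈)
      }
      where
      above : ∀ {w} → w ≢ u → AncestorOf q v w → AncestorOf q u w
      above w≢u [ e ]⁺    = contradiction (sym (Fin.suc-injective (trans (sym qv≡u) e))) w≢u
      above w≢u (e ∷ es) with refl ← trans (sym qv≡u) e = es
      adj⇔ : ∀ {w} → w ∈ done ∷ʳ u → w ∈ done ⊎ w ∈ u ∷ [] → v ~ w ⇔ AncestorOf q v w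
      adj⇔ _ (inj₂ (here refl)) = mk⇔ (const [ qv≡u ]⁺) (const (~-sym u~v))
      adj⇔ _ (inj₁ w∈done)      = mk⇔
        -- Adjacency to `u` is the bridge between the two assignments, because `u` satisfies the
        -- invariant both under `p` and under `q`.
        (λ v~w → qv≡u ∷ to (adj⇔ancestor placed-u w∈done)
          (from (adj⇔ancestor (waiting con u∉) w∈done)
            (ancestor-via {q = q} pv≡pu (to (adj⇔ancestor (waiting con (v∉ ∘ ∈-++⁺ˡ)) w∈done) v~w))))
        (λ anc → from (adj⇔ancestor (waiting con (v∉ ∘ ∈-++⁺ˡ)) w∈done)
            (ancestor-via {q = q} (sym pv≡pu) (to (adj⇔ancestor (waiting con u∉) w∈done)
              (from (adj⇔ancestor placed-u w∈done) (above (λ { refl → u∉ w∈done }) anc)))))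
    ... | no u≁v = record
      { parent∈      = log-⊆ ∈-++⁺ˡ (parent∈ placed-v)
      ; adj⇔ancestor = λ w∈ → adj⇔ (∈-++⁻ done w∈)
      }
      where
      placed-v : Placed q done v
      placed-v = keep-done (unchanged (inj₂ u≁v)) (waiting con (v∉ ∘ ∈-++⁺ˡ))
      adj⇔ : ∀ {w} → w ∈ done ⊎ w ∈ u ∷ [] → v ~ w ⇔ AncestorOf q v w
      adj⇔ (inj₁ w∈done)      = adj⇔ancestor placed-v w∈done
      adj⇔ (inj₂ (here refl)) = mk⇔ (λ v~u → contradiction (~-sym v~u) u≁v)
        (λ anc → contradiction (ancestor∈ closed-q (parent∈ placed-v) anc) u∉)

  -- Ancestors precede their descendants in `order`, which rules out cycles. The adjacency of two
  -- nodes is read off at the later one.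
  consistent⇒skeleton : ∀ {order p} → order ↭ allFin n → Unique order → Consistent order p →
    IsSkeleton G p
  consistent⇒skeleton {order} {p} perm un con = forest , adj
    where
    ∈-order : ∀ v → v ∈ order
    ∈-order v = ∈-resp-↭ (↭-sym perm) (∈-allFin v)

    ancestor∈earlier : ∀ {earlier v later w} → order ≡ earlier ++ v ∷ later → AncestorOf p v w →
      w ∈ earlier
    ancestor∈earlier eq = ancestor∈ (closed-earlier con eq) (parent∈ (processed con eq))

    forest : IsRootedForest p
    forest v anc with xs , _ , refl ← ∈-∃++ (∈-order v) =
      proj₁ (unique-middle xs un) (ancestor∈earlier refl anc)

    ancestor⇒adj : ∀ {v w} → AncestorOf p v w → v ~ w
    ancestor⇒adj {v} anc with _ , _ , eq ← ∈-∃++ (∈-order v) =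
      from (adj⇔ancestor (processed con eq) (ancestor∈earlier eq anc)) anc

    adj : ∀ u v → u ≢ v → u ~ v ⇔ (AncestorOf p v u ⊎ AncestorOf p u v)
    adj u v u≢v = mk⇔ adj⇒ancestor
      λ { (inj₁ anc) → ~-sym (ancestor⇒adj anc) ; (inj₂ anc) → ancestor⇒adj anc }
      where
      adj⇒ancestor : u ~ v → AncestorOf p v u ⊎ AncestorOf p u v
      adj⇒ancestor u~v with xs , ys , eq ← ∈-∃++ (∈-order v) with ∈-++⁻ xs (subst (u ∈_) eq (∈-order u))
      ... | inj₁ u∈xs         = inj₁ (to (adj⇔ancestor (processed con eq) u∈xs) (~-sym u~v))
      ... | inj₂ (here refl)  = contradiction refl u≢v
      ... | inj₂ (there u∈ys) with as , bs , refl ← ∈-∃++ u∈ys =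
        inj₂ (to (adj⇔ancestor
          (processed con (trans eq (sym (++-assoc xs (v ∷ as) (u ∷ bs))))) (∈-insert xs)) u~v)

-- As `vs` has no repetition and omits `u`, no update touches `p u` or the parent of a neighbour
-- still to be tested. Each test therefore compares values from the start of the scan.
scan-passed : ∀ (lg : Log n) u vs {p q} → Unique vs → u ∉ vs → scan lg u vs p ≡ passed q →
              (∀ {v} → v ∈ vs → suc v ∉ lg → p v ≡ p u × q v ≡ suc u) ×
              (∀ {v} → v ∉ vs ⊎ suc v ∈ lg → p v ≡ q v)
scan-passed lg u []       _           _  refl = (λ ()) , λ _ → refl
scan-passed lg u (v ∷ vs) {p} (v∉ ∷ un) u∉ eq with DecMembership._∈?_ Fin._≟_ (suc v) lg
... | yes v∈lg with upd , same ← scan-passed lg u vs un (u∉ ∘ there) eq =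
  (λ { (here refl) v∉lg → contradiction v∈lg v∉lg ; (there v′∈) → upd v′∈ }) ,
  (λ { (inj₁ v′∉) → same (inj₁ (v′∉ ∘ there)) ; (inj₂ v′∈lg) → same (inj₂ v′∈lg) })
... | no v∉lg with p u Fin.≟ p v
...   | yes pu≡pv with upd , same ← scan-passed lg u vs un (u∉ ∘ there) eq =
  (λ { (here refl) _ → sym pu≡pv
         , trans (sym (same (inj₁ (λ v∈ → All.lookup v∉ v∈ refl)))) (updateAt-updates v p)
     ; {v′} (there v′∈) v′∉lg → let p′v≡p′u , qv≡u = upd v′∈ v′∉lg in
         trans (sym (other (≢-sym (All.lookup v∉ v′∈)))) (trans p′v≡p′u (other (u∉ ∘ here))) , qv≡u }) ,
  (λ { (inj₁ v′∉) → trans (sym (other (v′∉ ∘ here))) (same (inj₁ (v′∉ ∘ there)))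
     ; (inj₂ v′∈lg) → trans (sym (other (λ { refl → v∉lg v′∈lg }))) (same (inj₂ v′∈lg)) })
  where
  other : ∀ {w} → w ≢ v → updateAt p v (const (suc u)) w ≡ p w
  other {w} w≢v = updateAt-minimal w v p w≢v

-- Successful tests may have changed the assignment before the failure, but neither at `u` nor at
-- `v`, so the two unequal parents date from before the scan.
scan-failed : ∀ (lg : Log n) u vs {p q v} → Unique vs → u ∉ vs → scan lg u vs p ≡ failedAt q v →
              v ∈ vs × suc v ∉ lg × q u ≢ q v × p u ≡ q u × p v ≡ q v
scan-failed lg u (v ∷ vs) {p} (v∉ ∷ un) u∉ eq with DecMembership._∈?_ Fin._≟_ (suc v) lg
... | yes v∈lg with v′∈ , rest ← scan-failed lg u vs un (u∉ ∘ there) eq = there v′∈ , rest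
... | no v∉lg with p u Fin.≟ p v
scan-failed lg u (v ∷ vs) {p} (v∉ ∷ un) u∉ refl | no v∉lg | no pu≢pv =
  here refl , v∉lg , pu≢pv , refl , refl
scan-failed lg u (v ∷ vs) {p} (v∉ ∷ un) u∉ eq | no v∉lg | yes pu≡pv
  with v′∈ , v′∉lg , qu≢qv , pu≡qu , pv≡qv ← scan-failed lg u vs un (u∉ ∘ there) eq =
  there v′∈ , v′∉lg , qu≢qv , trans (sym (updateAt-minimal u v p (u∉ ∘ here))) pu≡qu ,
  trans (sym (updateAt-minimal _ v p (≢-sym (All.lookup v∉ v′∈)))) pv≡qv

-- The chronological order

before-asym : ∀ {lg : Log n} {a b} → Unique lg → ProcessedBefore lg a b → ¬ ProcessedBefore lg b a
before-asym un (_ , ys , refl , a∈) (xs′ , _ , eq , b∈) with c₁ , c₂ , refl ← ∈-∃++ a∈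
  with refl , _ ← split-unique c₁ xs′ (subst Unique (++-assoc c₁ (_ ∷ c₂) (_ ∷ ys)) un)
                    (trans (sym (++-assoc c₁ (_ ∷ c₂) (_ ∷ ys))) eq) =
  proj₁ (unique-middle (c₁ ++ _ ∷ c₂) un) (∈-++⁺ˡ b∈)

before-irrefl : ∀ {lg : Log n} {a} → Unique lg → ¬ ProcessedBefore lg a a
before-irrefl un (xs , _ , refl , a∈) = proj₁ (unique-middle xs un) a∈

before-total : ∀ {lg : Log n} {a b} → a ∈ lg → b ∈ lg → a ≢ b →
  ProcessedBefore lg a b ⊎ ProcessedBefore lg b a
before-total {a = a} a∈ b∈ a≢b with xs , ys , refl ← ∈-∃++ b∈ with ∈-++⁻ xs a∈
... | inj₁ a∈xs         = inj₁ (xs , ys , refl , a∈xs)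
... | inj₂ (here refl)  = contradiction refl a≢b
... | inj₂ (there a∈ys) with as , bs , refl ← ∈-∃++ a∈ys =
  inj₂ (xs ++ _ ∷ as , bs , sym (++-assoc xs (_ ∷ as) (a ∷ bs)) , ∈-insert xs)

-- Nothing precedes `r`, the head of the log. Hence the later of two distinct parents is a node of
-- `V`, as the output requires.
before⇒nonroot : ∀ {done : List (Fin n)} {a b} → ProcessedBefore (log done) a b →
  ∃[ w ] b ≡ suc w × w ∈ done
before⇒nonroot (_ ∷ xs , ys , eq , _)
  with w , w∈ , refl ← ∈-map⁻ suc (subst (_ ∈_) (sym (proj₂ (∷-injective eq))) (∈-insert xs)) =
  w , refl , w∈

before-log : ∀ {earlier later : List (Fin n)} {w v} → w ∈ earlier →
             ProcessedBefore (log (earlier ++ v ∷ later)) (suc w) (suc v)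
before-log {earlier = earlier} {later} {v = v} w∈ =
  log earlier , List.map suc later , cong (r ∷_) (map-++ suc earlier (v ∷ later)) , suc∈log⁺ w∈

-- The four nodes found after a failed test

module _ (G : Graph n) where
  open Graph G
  open Placed
  open Consistent

  private
    G′ : Graph (suc n)
    G′ = withRoot G

  -- What the failure analysis needs from either end of the failed edge. Together, `parent∈`,
  -- `parent-adj` and `latest` make `p u` the last processed neighbour of `u` in the graph with
  -- root.
  record Waiting (done : List (Fin n)) (p : Parents n) (u : Fin n) : Set where
    field
      u∉         : u ∉ done
      parent∈    : p u ∈ log done
      parent-adj : Adj G′ (suc u) (p u)
      latest     : ∀ {w} → ProcessedBefore (log done) (p u) w → ¬ Adj G′ (suc u) w
      degree≤    : ∀ {w} → w ∈ done → degree G′ (suc u) ≤ degree G′ (suc w)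

  placed⇒waiting : ∀ {done p u} → Unique done → Consistent G done p → u ∉ done →
                   (∀ {w} → w ∈ done → degree G′ (suc u) ≤ degree G′ (suc w)) → Waiting done p u
  placed⇒waiting {done} {p} {u} un con u∉ deg = record
    { u∉ = u∉ ; parent∈ = parent∈ placed ; parent-adj = parent-adj′ ; latest = latest′ ; degree≤ = deg }
    where
    placed : Placed G p done u
    placed = waiting con u∉

    parent-adj′ : Adj G′ (suc u) (p u)
    parent-adj′ with p u in eq | parent∈ placed
    ... | r     | _  = tt
    ... | suc w | w∈ = from (adj⇔ancestor placed (suc∈log⁻ w∈)) [ eq ]⁺

    -- A processed neighbour `w` is an ancestor of `u`: either the parent itself or an ancestor of
    -- the parent, and those were processed before the parent.
    latest′ : ∀ {w} → ProcessedBefore (log done) (p u) w → ¬ Adj G′ (suc u) w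
    latest′ bef u~w with w , refl , w∈ ← before⇒nonroot bef with to (adj⇔ancestor placed w∈) u~w
    ... | [ e ]⁺ = before-irrefl (log-unique un)
      (subst (λ a → ProcessedBefore (log done) a (suc w)) e bef)
    ... | e ∷ es with _ , _ , refl ← ∈-∃++ (suc∈log⁻ (subst (_∈ log done) e (parent∈ placed))) =
      before-asym (log-unique un) (subst (λ a → ProcessedBefore (log done) a (suc w)) e bef)
        (before-log (ancestor∈ (closed-earlier con refl) (parent∈ (processed con refl)) es))

  module _ {done p a b} (wait-a : Waiting done p a) (wait-b : Waiting done p b) (a~b : a ~ b)
           (bef : ProcessedBefore (log done) (p b) (p a)) where

    private
      module a = Waiting wait-a
      module b = Waiting wait-b

    -- Otherwise the parent w of a, which is not adjacent to b, would satisfy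
    -- {b , w} ∪ N(w) ⊆ {a} ∪ N(a), contradicting d(a) ≤ d(w).
    fourth-node : ∃[ x ] x ≢ suc a × Adj G′ (p a) x × ¬ Adj G′ (suc a) x
    fourth-node with w , pa≡w , w∈ ← before⇒nonroot bef
      with Fin.any? (λ x → ¬? (x Fin.≟ suc a) ×-dec Graph._~?_ G′ (p a) x
                             ×-dec ¬? (Graph._~?_ G′ (suc a) x))
    ... | yes found = found
    ... | no ¬found = contradiction
      (ℕ.≤-trans (s≤s (a.degree≤ w∈)) (ℕ.≤-reflexive (sym (cong (suc ∘ degree G′) pa≡w))))
        (ℕ.<⇒≱ (unique-⊆⇒length≤ un ⊆))
      where
      un : Unique (suc b ∷ p a ∷ neighbours G′ (p a))
      -- `b` is unprocessed while `p a` is in the log, and `b` is not adjacent to `p a`, which was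
      -- processed after the last processed neighbour of `b`.
      un = ((λ b≡pa → b.u∉ (suc∈log⁻ (subst (_∈ log done) (sym b≡pa) a.parent∈))) ∷
             All.tabulate (λ { x∈ refl →
               b.latest bef (Graph.~-sym G′ {p a} {suc b} (∈-neighbours⁻ G′ (p a) x∈)) })) ∷
           All.tabulate (λ { x∈ refl → Graph.~-irrefl G′ {p a} (∈-neighbours⁻ G′ (p a) x∈) }) ∷
           neighbours-unique G′ (p a)
      ⊆ : suc b ∷ p a ∷ neighbours G′ (p a) ⊆ suc a ∷ neighbours G′ (suc a)
      ⊆ (here refl)              = there (∈-neighbours⁺ G′ (suc a) a~b)
      ⊆ (there (here refl))      = there (∈-neighbours⁺ G′ (suc a) a.parent-adj)
      ⊆ {x} (there (there x∈)) with x Fin.≟ suc a | Graph._~?_ G′ (suc a) x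
      ... | yes x≡a | _       = here x≡a
      ... | no _    | yes a~x = there (∈-neighbours⁺ G′ (suc a) {x} a~x)
      ... | no x≢a  | no a≁x  = contradiction (x , x≢a , ∈-neighbours⁻ G′ (p a) x∈ , a≁x) ¬found

    -- The path is `b`, `a`, `w`, `x`. The chord from `b` to `w` is excluded by `b.latest`, the
    -- chord from `a` to `x` by the choice of `x`.
    finds⇒induces : ∀ {q} → Finds G (log done) p a b q →
                    ∃[ nodes ] q ≡ Vec.map suc nodes × (Induces G nodes P₄ ⊎ Induces G nodes C₄)
    -- `x` cannot be `r`, which is adjacent to every node of `V`.
    finds⇒induces (finds {r}     _ _ _ a≁x) = contradiction tt a≁x
    finds⇒induces (finds {suc x} _ x≢a w~x a≁x) with w , pa≡w , w∈ ← before⇒nonroot bef =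
      b ∷ a ∷ w ∷ x ∷ [] , cong (λ y → suc b ∷ suc a ∷ y ∷ suc x ∷ []) pa≡w ,
      induces-P₄⊎C₄ G (~-sym a~b) (subst (Adj G′ (suc a)) pa≡w a.parent-adj)
        (subst (λ y → Adj G′ y (suc x)) pa≡w w~x)
        (λ { refl → b.u∉ w∈ }) (λ { refl → x≢a refl })
        (b.latest bef ∘ subst (Adj G′ (suc b)) (sym pa≡w)) a≁x

-- Completed and failed runs

module _ (G : Graph n) (L : AdjacencyLists G) where
  open Graph G
  open AdjacencyLists L

  private
    u∉nbrs : ∀ u → u ∉ nbrs u
    u∉nbrs u = ~-irrefl ∘ nbrs-sound

  scan-updates : ∀ {done u p q} → scan (log done) u (nbrs u) p ≡ passed q → Updates G done u p q
  scan-updates {done} {u} eq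
    with upd , same ← scan-passed (log done) u (nbrs u) (nbrs-unique u) (u∉nbrs u) eq =
    record
    { updated   = λ v∉ u~v → upd (nbrs-complete u~v) (v∉ ∘ suc∈log⁻)
    ; unchanged = λ { (inj₁ v∈)  → same (inj₂ (suc∈log⁺ v∈))
                    ; (inj₂ u≁v) → same (inj₁ (u≁v ∘ nbrs-sound)) }
    }

  process-completed : ∀ done todo {p q} → Unique (done ++ todo) → Consistent G done p →
                      process nbrs todo (log done) p ≡ completed q → Consistent G (done ++ todo) q
  process-completed done []         _  con refl =
    subst (λ xs → Consistent G xs _) (sym (++-identityʳ done)) con
  process-completed done (u ∷ todo) {p} un con eq with scan (log done) u (nbrs u) p in scan≡
  ... | passed p′ = subst (λ xs → Consistent G xs _) (++-assoc done (u ∷ []) todo)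
    (process-completed (done ∷ʳ u) todo (subst Unique (sym (++-assoc done (u ∷ []) todo)) un)
      (consistent-∷ʳ G (proj₁ (unique-middle done un)) con (scan-updates scan≡))
      (trans (cong (λ lg → process nbrs todo lg p′) (sym (log-∷ʳ done u))) eq))

  -- Two assignments are kept: `p` at the moment of failure, of which the output speaks, and
  -- `before`, for which the invariant holds. They are tied together at `u` and `v`.
  record Conflict (order : List (Fin n)) (lg : Log n) (p : Parents n) (u v : Fin n) : Set where
    field
      {done todo} : List (Fin n)
      order≡      : order ≡ done ++ u ∷ todo
      log≡        : lg ≡ log done
      v∉          : v ∉ done
      u~v         : u ~ v
      pu≢pv       : p u ≢ p v
      -- The parent assignment when the scan of u started.
      {before}    : Parents n
      consistent  : Consistent G done before
      before-u    : before u ≡ p u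
      before-v    : before v ≡ p v

  process-failed : ∀ done todo {p lg q u v} → Unique (done ++ todo) → Consistent G done p →
                   process nbrs todo (log done) p ≡ failed lg q u v → Conflict (done ++ todo) lg q u v
  process-failed done (u ∷ todo) {p} un con eq with scan (log done) u (nbrs u) p in scan≡
  ... | passed p′ = subst (λ xs → Conflict xs _ _ _ _) (++-assoc done (u ∷ []) todo)
    (process-failed (done ∷ʳ u) todo (subst Unique (sym (++-assoc done (u ∷ []) todo)) un)
      (consistent-∷ʳ G (proj₁ (unique-middle done un)) con (scan-updates scan≡))
      (trans (cong (λ lg → process nbrs todo lg p′) (sym (log-∷ʳ done u))) eq))
  process-failed done (u ∷ todo) un con refl | failedAt q v
    with v∈ , v∉lg , qu≢qv , pu≡qu , pv≡qv ← scan-failed (log done) u (nbrs u) (nbrs-unique u)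
      (u∉nbrs u) scan≡ =
    record { order≡ = refl ; log≡ = refl ; v∉ = v∉lg ∘ suc∈log⁺ ; u~v = nbrs-sound v∈ ; pu≢pv = qu≢qv
           ; consistent = con ; before-u = pu≡qu ; before-v = pv≡qv }

  module _ {order} (dec : IsDecreasingDegreeOrder G order) where

    private
      perm : order ↭ allFin n
      perm = proj₁ dec

    order-unique : Unique order
    order-unique = PermSetoid.Unique-resp-↭ (setoid (Fin n)) (↭⇒↭ₛ (↭-sym perm)) (Unique.allFin⁺ n)

    ∈-order : ∀ v → v ∈ order
    ∈-order v = ∈-resp-↭ (↭-sym perm) (∈-allFin v)

    recognize-completed : ∀ {p} → recognize nbrs order ≡ completed p → IsSkeleton G p
    recognize-completed = consistent⇒skeleton G perm order-unique ∘
      process-completed [] order order-unique (consistent-[] G)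

    recognize-failed : ∀ {lg p u v} → recognize nbrs order ≡ failed lg p u v → Conflict order lg p u v
    recognize-failed = process-failed [] order order-unique (consistent-[] G)

    module _ {lg p u v} (conflict : Conflict order lg p u v) where
      open Conflict conflict

      private
        un : Unique done
        un = unique-prefix done (subst Unique order≡ order-unique)

        -- `Waiting` mentions the assignment only at `a`, so it can be derived for `before` and then
        -- carried over to `p`.
        unprocessed : ∀ {a} → a ∉ done → before a ≡ p a → Waiting G done p a
        unprocessed {a} a∉ e = record
          { u∉         = a∉
          ; parent∈    = subst (_∈ log done) e w.parent∈
          ; parent-adj = subst (Adj (withRoot G) (suc a)) e w.parent-adj
          ; latest     = w.latest ∘ subst (λ b → ProcessedBefore (log done) b _) (sym e)
          ; degree≤    = w.degree≤
          }
          where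
          a∈ : a ∈ u ∷ todo
          a∈ with ∈-++⁻ done (subst (a ∈_) order≡ (∈-order a))
          ... | inj₁ a∈done = contradiction a∈done a∉
          ... | inj₂ a∈rest = a∈rest
          module w = Waiting (placed⇒waiting G un consistent a∉
                                (λ w∈ → all-pairs-++ (subst (AllPairs _) order≡ (proj₂ dec)) w∈ a∈))

      conflict-u : Waiting G done p u
      conflict-u = unprocessed (proj₁ (unique-middle done (subst Unique order≡ order-unique))) before-u

      conflict-v : Waiting G done p v
      conflict-v = unprocessed v∉ before-v

      conflict-outputs : ∃[ q ] Outputs G lg p u v q
      conflict-outputs = subst (λ lg → ∃[ q ] Outputs G lg p u v q) (sym log≡) outputs
        where
        outputs : ∃[ q ] Outputs G (log done) p u v q
        outputs with before-total (Waiting.parent∈ conflict-v) (Waiting.parent∈ conflict-u)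
          (≢-sym pu≢pv)
        ... | inj₁ bef with _ , x≢ , adj , nadj ← fourth-node G conflict-u conflict-v u~v bef =
          _ , inj₁ (finds bef x≢ adj nadj)
        ... | inj₂ bef with _ , x≢ , adj , nadj ← fourth-node G conflict-v conflict-u (~-sym u~v) bef =
          _ , inj₂ (finds bef x≢ adj nadj)

      outputs⇒induces : ∀ {q} → Outputs G lg p u v q →
                        ∃[ nodes ] q ≡ Vec.map suc nodes × (Induces G nodes P₄ ⊎ Induces G nodes C₄)
      outputs⇒induces {q} out with subst (λ lg → Outputs G lg p u v q) log≡ out
      ... | inj₁ found@(finds bef _ _ _) = finds⇒induces G conflict-u conflict-v u~v bef found
      ... | inj₂ found@(finds bef _ _ _) = finds⇒induces G conflict-v conflict-u (~-sym u~v) bef found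

      conflict⇒¬quasi-threshold : ¬ IsQuasiThreshold G
      conflict⇒¬quasi-threshold (noP₄ , noC₄) with outputs⇒induces (proj₂ conflict-outputs)
      ... | _ , _ , inj₁ (copy , _) = noP₄ copy
      ... | _ , _ , inj₂ (copy , _) = noC₄ copy

-- Correctness and cost of commands

T-true : ∀ {b} → b ≡ true → T b
T-true refl = tt

T-false : ∀ {b} → b ≡ false → ¬ T b
T-false refl ()

≡ᵇ-true : ∀ {k l} → (k ≡ᵇ l) ≡ true → k ≡ l
≡ᵇ-true {k} {l} = ℕ.≡ᵇ⇒≡ k l ∘ T-true

≡ᵇ-false : ∀ {k l} → (k ≡ᵇ l) ≡ false → k ≢ l
≡ᵇ-false {k} {l} eq = T-false eq ∘ ℕ.≡⇒≡ᵇ k l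

update-same : ∀ (f : ℕ → A) k {a} → (f [ k ≔ a ]) k ≡ a
update-same f k with k ≡ᵇ k in eq
... | true  = refl
... | false = contradiction refl (≡ᵇ-false {k} eq)

update-other : ∀ (f : ℕ → A) {k l a} → l ≢ k → (f [ k ≔ a ]) l ≡ f l
update-other f {k} {l} l≢k with l ≡ᵇ k in eq
... | true  = contradiction (≡ᵇ-true eq) l≢k
... | false = refl

length-∷ʳ : ∀ (xs : List A) x → length (xs ∷ʳ x) ≡ suc (length xs)
length-∷ʳ xs x = trans (length-++ xs) (ℕ.+-comm (length xs) 1)

-- A Hoare triple with a time bound, for a fixed initial store; preconditions appear as hypotheses
-- of the lemmas that construct it.
record Run (c : Cmd) (s : Store) (Q : Store → Set) (t : ℕ) : Set where
  constructor run
  field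
    post : Q (exec c s)
    cost : time c s ≤ t

private variable
  P Q : Store → Set
  c c₁ c₂ : Cmd
  s : Store
  t t₁ t₂ : ℕ
  e e₁ e₂ : Expr

run-≤ : t₁ ≤ t₂ → Run c s Q t₁ → Run c s Q t₂
run-≤ t₁≤t₂ (run q c≤) = run q (ℕ.≤-trans c≤ t₁≤t₂)

run-map : (∀ {s} → P s → Q s) → Run c s P t → Run c s Q t
run-map P⇒Q (run p c≤) = run (P⇒Q p) c≤

run-⨾ : Run c₁ s P t₁ → (∀ {s′} → P s′ → Run c₂ s′ Q t₂) → Run (c₁ ⨾ c₂) s Q (t₁ + t₂)
run-⨾ (run p c₁≤) next = run (Run.post (next p)) (ℕ.+-mono-≤ c₁≤ (Run.cost (next p)))

run-IF-== : (eval e₁ s ≡ eval e₂ s → Run c₁ s Q t) → (eval e₁ s ≢ eval e₂ s → Run c₂ s Q t) →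
            Run (IF e₁ == e₂ THEN c₁ ELSE c₂) s Q (1 + costT (e₁ == e₂) + t)
run-IF-== {e₁} {s} {e₂} {c₁} {Q} {t} {c₂} then else = run post cost
  where
  post : Q (exec (IF e₁ == e₂ THEN c₁ ELSE c₂) s)
  post with eval e₁ s ≡ᵇ eval e₂ s in eq
  ... | true  = Run.post (then (≡ᵇ-true eq))
  ... | false = Run.post (else (≡ᵇ-false eq))
  cost : time (IF e₁ == e₂ THEN c₁ ELSE c₂) s ≤ 1 + costT (e₁ == e₂) + t
  cost with eval e₁ s ≡ᵇ eval e₂ s in eq
  ... | true  = ℕ.+-monoʳ-≤ (1 + costT (e₁ == e₂)) (Run.cost (then (≡ᵇ-true eq)))
  ... | false = ℕ.+-monoʳ-≤ (1 + costT (e₁ == e₂)) (Run.cost (else (≡ᵇ-false eq)))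

run-IF-≺ : (eval e₁ s < eval e₂ s → Run c₁ s Q t) → (¬ eval e₁ s < eval e₂ s → Run c₂ s Q t) →
           Run (IF e₁ ≺ e₂ THEN c₁ ELSE c₂) s Q (1 + costT (e₁ ≺ e₂) + t)
run-IF-≺ {e₁} {s} {e₂} {c₁} {Q} {t} {c₂} then else = run post cost
  where
  post : Q (exec (IF e₁ ≺ e₂ THEN c₁ ELSE c₂) s)
  post with eval e₁ s <ᵇ eval e₂ s in eq
  ... | true  = Run.post (then (ℕ.<ᵇ⇒< _ _ (T-true eq)))
  ... | false = Run.post (else (T-false eq ∘ ℕ.<⇒<ᵇ))
  cost : time (IF e₁ ≺ e₂ THEN c₁ ELSE c₂) s ≤ 1 + costT (e₁ ≺ e₂) + t
  cost with eval e₁ s <ᵇ eval e₂ s in eq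
  ... | true  = ℕ.+-monoʳ-≤ (1 + costT (e₁ ≺ e₂)) (Run.cost (then (ℕ.<ᵇ⇒< _ _ (T-true eq))))
  ... | false = ℕ.+-monoʳ-≤ (1 + costT (e₁ ≺ e₂)) (Run.cost (else (T-false eq ∘ ℕ.<⇒<ᵇ)))

-- The counter is the number of list entries already treated. The invariant sees both the treated
-- and the remaining entries, and `T y` plus one loop step is charged to the entry `y`.
run-FOR : ∀ {x} {xs : List A} (I : List A → List A → Store → Set) (T : A → ℕ) →
          eval e s ≡ length xs → I [] xs s →
          (∀ {done y todo s′} → xs ≡ done ++ y ∷ todo → I done (y ∷ todo) s′ →
            Run c (setReg x (length done) s′) (I (done ∷ʳ y) todo) (T y)) →
          Run (FOR x < e DO c) s (I xs []) (1 + costE e + sum (List.map (suc ∘ T) xs))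
run-FOR {A} {e} {s} {c} {x} {xs} I T e≡ init step =
  run (subst (λ k → I xs [] (iterate k body s)) (sym e≡) (proj₁ whole))
      (ℕ.+-monoʳ-≤ (1 + costE e)
        (subst (λ k → iterateTime k body cost-at s ≤ _) (sym e≡) (proj₂ whole)))
  where
  body : ℕ → Store → Store
  body k s′ = exec c (setReg x k s′)
  cost-at : ℕ → Store → ℕ
  cost-at k s′ = time c (setReg x k s′)
  step′ : ∀ {k done y todo s′} → length done ≡ k → xs ≡ done ++ y ∷ todo → I done (y ∷ todo) s′ →
          Run c (setReg x k s′) (I (done ∷ʳ y) todo) (T y)
  step′ refl = step
  go : ∀ k done todo → length done ≡ k → xs ≡ done ++ todo →
       I done todo (iterate k body s) × iterateTime k body cost-at s ≤ sum (List.map (suc ∘ T) done)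
  -- `iterate` applies its last index outermost, so the treated part is taken apart from its end.
  go k done todo len eq with initLast done
  go zero    _ todo _   eq | []         = subst (λ ys → I [] ys s) eq init , z≤n
  go zero    _ todo len eq | done ∷ʳ′ y with () ← trans (sym (length-∷ʳ done y)) len
  go (suc k) _ todo len eq | done ∷ʳ′ y = Run.post last , (begin
      iterateTime k body cost-at s + suc (cost-at k (iterate k body s))
        ≤⟨ ℕ.+-mono-≤ (proj₂ before) (s≤s (Run.cost last)) ⟩
      sum (List.map (suc ∘ T) done) + suc (T y)
        ≡⟨ cong (sum (List.map (suc ∘ T) done) +_) (ℕ.+-identityʳ (suc (T y))) ⟨
      sum (List.map (suc ∘ T) done) + sum (List.map (suc ∘ T) (y ∷ []))
        ≡⟨ sum-++ (List.map (suc ∘ T) done) _ ⟨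
      sum (List.map (suc ∘ T) done ++ List.map (suc ∘ T) (y ∷ []))
        ≡⟨ cong sum (map-++ (suc ∘ T) done (y ∷ [])) ⟨
      sum (List.map (suc ∘ T) (done ∷ʳ y)) ∎)
    where
    open ℕ.≤-Reasoning
    len′ : length done ≡ k
    len′ = ℕ.suc-injective (trans (sym (length-∷ʳ done y)) len)
    eq′ : xs ≡ done ++ y ∷ todo
    eq′ = trans eq (++-assoc done (y ∷ []) todo)
    before : I done (y ∷ todo) (iterate k body s) ×
      iterateTime k body cost-at s ≤ sum (List.map (suc ∘ T) done)
    before = go k done (y ∷ todo) len′ eq′
    last : Run c (setReg x k (iterate k body s)) (I (done ∷ʳ y) todo) (T y)
    last = step′ len′ eq′ (proj₁ before)
  whole : I xs [] (iterate (length xs) body s) ×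
    iterateTime (length xs) body cost-at s ≤ sum (List.map (suc ∘ T) xs)
  whole = go (length xs) xs [] refl (sym (++-identityʳ xs))

sum-affine : ∀ (f : A → ℕ) a b xs →
             sum (List.map (λ y → suc (a + f y * b)) xs) ≡ length xs * suc a + sum (List.map f xs) * b
sum-affine f a b []       = refl
sum-affine f a b (x ∷ xs) = begin
  suc (a + f x * b) + sum (List.map (λ y → suc (a + f y * b)) xs)
    ≡⟨ cong (suc (a + f x * b) +_) (sum-affine f a b xs) ⟩
  (suc a + f x * b) + (length xs * suc a + F * b)
    ≡⟨ interchange (suc a) (f x * b) (length xs * suc a) (F * b) ⟩
  suc a + length xs * suc a + (f x * b + F * b)
    ≡⟨ cong (suc a + length xs * suc a +_) (ℕ.*-distribʳ-+ b (f x) F) ⟨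
  suc a + length xs * suc a + (f x + F) * b                  ∎
  where
  open ≡-Reasoning
  open import Algebra.Properties.CommutativeSemigroup ℕ.+-commutativeSemigroup using (interchange)
  F : ℕ
  F = sum (List.map f xs)

run-FOR-const : ∀ {x} {xs : List A} (I : List A → List A → Store → Set) a →
                eval e s ≡ length xs → I [] xs s →
                (∀ {done y todo s′} → xs ≡ done ++ y ∷ todo → I done (y ∷ todo) s′ →
                  Run c (setReg x (length done) s′) (I (done ∷ʳ y) todo) a) →
                Run (FOR x < e DO c) s (I xs []) (1 + costE e + length xs * suc a)
run-FOR-const {e = e} {xs = xs} I a e≡ init step =
  run-≤ (ℕ.≤-reflexive (cong (1 + costE e +_) (sum-const xs))) (run-FOR I (const a) e≡ init step)
  where
  sum-const : ∀ (xs : List A) → sum (List.map (const (suc a)) xs) ≡ length xs * suc a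
  sum-const []       = refl
  sum-const (_ ∷ xs) = cong (suc a +_) (sum-const xs)

-- The parameter z stands for the size 1 + n + m of the input.
module Linear (z : ℕ) (1≤z : 1 ≤ z) where

  -- The record makes `k` visible to unification, which could not recover it from `k * z`. Constants
  -- of successive commands then simply add up.
  record LinearRun (c : Cmd) (s : Store) (Q : Store → Set) (k : ℕ) : Set where
    constructor linear
    field
      linear-run : Run c s Q (k * z)

  open LinearRun public

  const≤ : ∀ a → a ≤ a * z
  const≤ a = ℕ.≤-trans (ℕ.≤-reflexive (sym (ℕ.*-identityʳ a))) (ℕ.*-monoʳ-≤ a 1≤z)

  linear-const : ∀ {k} → Run c s Q k → LinearRun c s Q k
  linear-const {k = k} = linear ∘ run-≤ (const≤ k)

  linear-map : ∀ {k} → (∀ {s} → P s → Q s) → LinearRun c s P k → LinearRun c s Q k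
  linear-map P⇒Q = linear ∘ run-map P⇒Q ∘ linear-run

  infixr 2 _⟫_
  _⟫_ : ∀ {k₁ k₂} → LinearRun c₁ s P k₁ → (∀ {s′} → P s′ → LinearRun c₂ s′ Q k₂) →
        LinearRun (c₁ ⨾ c₂) s Q (k₁ + k₂)
  _⟫_ {k₁ = k₁} {k₂} first second = linear
    (run-≤ (ℕ.≤-reflexive (sym (ℕ.*-distribʳ-+ z k₁ k₂)))
      (run-⨾ (linear-run first) (linear-run ∘ second)))

  linear-IF-== : ∀ {e₁ e₂ k} → (eval e₁ s ≡ eval e₂ s → LinearRun c₁ s Q k) →
                 (eval e₁ s ≢ eval e₂ s → LinearRun c₂ s Q k) →
                 LinearRun (IF e₁ == e₂ THEN c₁ ELSE c₂) s Q (1 + costT (e₁ == e₂) + k)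
  linear-IF-== {e₁ = e₁} {e₂} {k} then else = linear (run-≤
    (ℕ.≤-trans (ℕ.+-monoˡ-≤ (k * z) (const≤ (1 + costT (e₁ == e₂))))
      (ℕ.≤-reflexive (sym (ℕ.*-distribʳ-+ z (1 + costT (e₁ == e₂)) k))))
    (run-IF-== (linear-run ∘ then) (linear-run ∘ else)))

  -- The rule for nested loops: `f y` is the number of inner rounds and `b` the price of one. The
  -- factor 2 in the bound on their sum is due to the degrees, which count every edge twice.
  linear-FOR : ∀ {x} {xs : List A} (I : List A → List A → Store → Set) (f : A → ℕ) a b →
               length xs ≤ z → sum (List.map f xs) ≤ 2 * z →
               eval e s ≡ length xs → I [] xs s →
               (∀ {done y todo s′} → xs ≡ done ++ y ∷ todo → I done (y ∷ todo) s′ →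
                 Run c (setReg x (length done) s′) (I (done ∷ʳ y) todo) (a + f y * b)) →
               LinearRun (FOR x < e DO c) s (I xs []) (1 + costE e + (suc a + 2 * b))
  linear-FOR {e = e} {xs = xs} I f a b l≤z F≤2z e≡ init step = linear
    (run-≤ (begin
      1 + costE e + sum (List.map (λ y → suc (a + f y * b)) xs)
        ≡⟨ cong (1 + costE e +_) (sum-affine f a b xs) ⟩
      1 + costE e + (length xs * suc a + sum (List.map f xs) * b)
        ≤⟨ ℕ.+-mono-≤ (const≤ (1 + costE e))
          (ℕ.+-mono-≤ (ℕ.*-monoˡ-≤ (suc a) l≤z) (ℕ.*-monoˡ-≤ b F≤2z)) ⟩
      (1 + costE e) * z + (z * suc a + 2 * z * b)
        ≡⟨ solve 4 (λ z e a b → (con 1 :+ e) :* z :+ (z :* (con 1 :+ a) :+ con 2 :* z :* b) :=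
                                (con 1 :+ e :+ (con 1 :+ a :+ con 2 :* b)) :* z) refl z (costE e) a b ⟩
      (1 + costE e + (suc a + 2 * b)) * z ∎)
      (run-FOR I (λ y → a + f y * b) e≡ init step))
    where
    open ℕ.≤-Reasoning
    open +-*-Solver

  linear-FOR-const : ∀ {x} {xs : List A} (I : List A → List A → Store → Set) a →
                     length xs ≤ z → eval e s ≡ length xs → I [] xs s →
                     (∀ {done y todo s′} → xs ≡ done ++ y ∷ todo → I done (y ∷ todo) s′ →
                       Run c (setReg x (length done) s′) (I (done ∷ʳ y) todo) a) →
                     LinearRun (FOR x < e DO c) s (I xs []) (1 + costE e + suc a)
  linear-FOR-const {e = e} {xs = xs} I a l≤z e≡ init step = linear
    (run-≤ (begin
      1 + costE e + length xs * suc a ≤⟨ ℕ.+-mono-≤ (const≤ (1 + costE e)) (ℕ.*-monoˡ-≤ (suc a) l≤z) ⟩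
      (1 + costE e) * z + z * suc a   ≡⟨ cong ((1 + costE e) * z +_) (ℕ.*-comm z (suc a)) ⟩
      (1 + costE e) * z + suc a * z   ≡⟨ ℕ.*-distribʳ-+ z (1 + costE e) (suc a) ⟨
      (1 + costE e + suc a) * z       ∎)
      (run-FOR-const I a e≡ init step))
    where open ℕ.≤-Reasoning

-- Counting

tabulate-index : ∀ {m} (f : Fin m → A) {done y todo} → tabulate f ≡ done ++ y ∷ todo →
                 ∃[ i ] toℕ i ≡ length done × f i ≡ y
tabulate-index {m = zero}  f {[]}       ()
tabulate-index {m = zero}  f {_ ∷ _}    ()
tabulate-index {m = suc m} f {[]}       eq = zero , refl , proj₁ (∷-injective eq)
tabulate-index {m = suc m} f {_ ∷ done} eq
  with i , i≡ , fi≡y ← tabulate-index (f ∘ suc) {done} (proj₂ (∷-injective eq)) =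
  suc i , cong suc i≡ , fi≡y

allFin-index : ∀ {done todo} {u : Fin n} → allFin n ≡ done ++ u ∷ todo → length done ≡ toℕ u
allFin-index {done = done} eq with _ , i≡ , refl ← tabulate-index id {done} eq = sym i≡

allFin-code : ∀ {done todo} {u : Fin n} → allFin n ≡ done ++ u ∷ todo → length done + 1 ≡ code (suc u)
allFin-code {done = done} eq =
  trans (ℕ.+-comm (length done) 1) (cong suc (allFin-index {done = done} eq))

-- Matches the assignment to `D` in the collecting loop, which visits the buckets from the largest
-- possible degree down to `0`.
downFrom-index : ∀ n {done d todo} → downFrom n ≡ done ++ d ∷ todo → n ∸ (length done + 1) ≡ d × d < n
downFrom-index zero    {[]}       ()
downFrom-index zero    {_ ∷ _}    ()
downFrom-index (suc n) {[]}       eq =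
  proj₁ (∷-injective eq) , ℕ.≤-reflexive (cong suc (sym (proj₁ (∷-injective eq))))
downFrom-index (suc n) {_ ∷ done} eq
  with d≡ , d< ← downFrom-index n {done} (proj₂ (∷-injective eq)) =
  d≡ , ℕ.m<n⇒m<1+n d<

lookup-index-++ : ∀ {xs : List A} {vs v ws} → xs ≡ vs ++ v ∷ ws →
  ∃[ j ] toℕ {length xs} j ≡ length vs × List.lookup xs j ≡ v
lookup-index-++ {vs = []}     refl = zero , refl , refl
lookup-index-++ {vs = x ∷ vs} refl with j , j≡ , eq ← lookup-index-++ {vs = vs} refl =
  suc j , cong suc j≡ , eq

module _ {G : Graph n} (L : AdjacencyLists G) where
  open Graph G
  open AdjacencyLists L

  deg : Fin n → ℕ
  deg u = length (nbrs u)

  -- The additional one is contributed by `r`; sorting by the degrees in `G` is therefore as good as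
  -- sorting by those in the graph with root.
  degree≡deg : ∀ u → degree (withRoot G) (suc u) ≡ suc (deg u)
  degree≡deg u = trans
    (ℕ.≤-antisym
      (unique-⊆⇒length≤ (neighbours-unique (withRoot G) (suc u)) (λ {x} → ⊆ x))
      (unique-⊆⇒length≤ (log-unique (nbrs-unique u)) (λ {x} → ⊇ x)))
    (cong suc (length-map suc (nbrs u)))
    where
    ⊆ : ∀ x → x ∈ neighbours (withRoot G) (suc u) → x ∈ log (nbrs u)
    ⊆ r       _  = here refl
    ⊆ (suc v) v∈ = suc∈log⁺ (nbrs-complete (∈-neighbours⁻ (withRoot G) (suc u) v∈))
    ⊇ : ∀ x → x ∈ log (nbrs u) → x ∈ neighbours (withRoot G) (suc u)
    ⊇ r       _  = ∈-neighbours⁺ (withRoot G) (suc u) tt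
    ⊇ (suc v) v∈ = ∈-neighbours⁺ (withRoot G) (suc u) {suc v} (nbrs-sound (suc∈log⁻ v∈))

  -- `u` followed by its neighbours is still free of repetitions. Hence every degree is the number
  -- of one of the `n` buckets.
  deg<n : ∀ u → deg u < n
  deg<n u = subst (suc (deg u) ≤_) (length-tabulate id)
    (unique-⊆⇒length≤ {xs = u ∷ nbrs u}
      (All.tabulate (λ { v∈ refl → ~-irrefl (nbrs-sound v∈) }) ∷ nbrs-unique u) (λ _ → ∈-allFin _))

  -- Half of the handshake lemma: every arc is a listed edge or the reversal of one, and distinct
  -- nodes have disjoint arcs.
  sum-deg≤2edges : sum (List.map deg (allFin n)) ≤ 2 * length (edges G)
  sum-deg≤2edges = begin
    sum (List.map deg (allFin n))                    ≡⟨ length-arcs (allFin n) ⟨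
    length (concatMap arcs (allFin n))
      ≤⟨ unique-⊆⇒length≤ (arcs-unique (Unique.allFin⁺ n)) arc∈ ⟩
    length (edges G ++ List.map Product.swap (edges G)) ≡⟨ length-++ (edges G) ⟩
    length (edges G) + length (List.map Product.swap (edges G))
      ≡⟨ cong (length (edges G) +_) (length-map Product.swap (edges G)) ⟩
    length (edges G) + length (edges G)
      ≡⟨ cong (length (edges G) +_) (ℕ.+-identityʳ (length (edges G))) ⟨
    2 * length (edges G)                        ∎
    where
    open ℕ.≤-Reasoning
    arcs : Fin n → List (Fin n × Fin n)
    arcs u = List.map (u ,_) (nbrs u)
    length-arcs : ∀ us → length (concatMap arcs us) ≡ sum (List.map deg us)
    length-arcs []       = refl
    length-arcs (u ∷ us) = trans (length-++ (arcs u))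
      (cong₂ _+_ (length-map (u ,_) (nbrs u)) (length-arcs us))
    arcs-unique : ∀ {us} → Unique us → Unique (concatMap arcs us)
    arcs-unique un = Unique.concat⁺
      (All.map⁺ (All.universal (λ u → Unique.map⁺ ,-injectiveʳ (nbrs-unique u)) _))
      (AllPairs.map⁺ (AllPairs.map disjoint un))
      where
      disjoint : ∀ {u v} → u ≢ v → Disjoint (arcs u) (arcs v)
      disjoint u≢v (x∈ , x∈′) with _ , _ , refl ← ∈-map⁻ (_ ,_) x∈ | _ , _ , e ← ∈-map⁻ (_ ,_) x∈′ =
        u≢v (,-injectiveˡ e)
    edge∈ : ∀ {u v} → u Fin.< v → u ~ v → (u , v) ∈ edges G
    edge∈ u<v u~v = ∈-filter⁺ (λ (u , v) → (u Fin.<? v) ×-dec (u ~? v))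
      (∈-cartesianProduct⁺ (∈-allFin _) (∈-allFin _)) (u<v , u~v)
    arc∈ : concatMap arcs (allFin n) ⊆ edges G ++ List.map Product.swap (edges G)
    arc∈ {u , v} uv∈ with Any.satisfied (∈-concatMap⁻ arcs {xs = allFin n} uv∈)
    ... | _ , uv∈arcs with _ , v∈ , refl ← ∈-map⁻ (_ ,_) uv∈arcs with Fin.<-cmp u v
    ...   | tri< u<v _ _  = ∈-++⁺ˡ (edge∈ u<v (nbrs-sound v∈))
    ...   | tri≈ _ refl _ = contradiction (nbrs-sound v∈) ~-irrefl
    ...   | tri> _ _ v<u  = ∈-++⁺ʳ (edges G) (∈-map⁺ Product.swap (edge∈ v<u (~-sym (nbrs-sound v∈))))

all-pairs-∈ : ∀ {R : A → A → Set} {xs} → (∀ {x y} → x ∈ xs → y ∈ xs → R x y) → AllPairs R xs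
all-pairs-∈ {xs = []}     Rxy = []
all-pairs-∈ {xs = x ∷ xs} Rxy =
  All.tabulate (λ y∈ → Rxy (here refl) (there y∈)) ∷ all-pairs-∈ (λ x∈ y∈ → Rxy (there x∈) (there y∈))

unique-set⇒↭ : ∀ {xs ys : List A} → Unique xs → Unique ys → (∀ {x} → x ∈ xs ⇔ x ∈ ys) → xs ↭ ys
unique-set⇒↭ un un′ set = ∼bag⇒↭ (unique∧set⇒bag un un′ set)

-- The stored graph and the sorted nodes

-- A linked list whose length is known from `SIZE`; there is no end marker, so the empty list
-- accepts any pointer.
Chain : (ℕ → ℕ) → ℕ → List (Fin n) → Set
Chain next h []       = ⊤
Chain next h (u ∷ us) = h ≡ code (suc u) × Chain next (next h) us

chain-update : ∀ {next h a} {u : Fin n} us → u ∉ us → Chain next h us →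
               Chain (next [ code (suc u) ≔ a ]) h us
chain-update []       _  _ = tt
chain-update {next = next} {a = a} {u} (v ∷ us) u∉ (refl , ch) =
  refl , subst (λ h → Chain (next [ code (suc u) ≔ a ]) h us)
    (sym (update-other next {code (suc u)} (λ eq →
      u∉ (here (Fin.toℕ-injective (sym (ℕ.suc-injective eq)))))))
    (chain-update us (u∉ ∘ there) ch)

-- Ranks are positions in `log order`: `r` has rank 0, which shifts ranks by one against the indices
-- of `ORDER`.
record IsRanking (order : List (Fin n)) (k : ℕ) (ord rank : ℕ → ℕ) : Set where
  field
    count     : k ≡ length order
    rank-root : rank 0 ≡ 0
    entry     : ∀ {xs u ys} → order ≡ xs ++ u ∷ ys →
                ord (length xs) ≡ code (suc u) × rank (code (suc u)) ≡ suc (length xs)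

open IsRanking

ranking-∷ʳ : ∀ {order k ord rank h} {u : Fin n} → u ∉ order → h ≡ code (suc u) →
             IsRanking order k ord rank →
             IsRanking (order ∷ʳ u) (k + 1) (ord [ k ≔ h ]) (rank [ h ≔ k + 1 ])
ranking-∷ʳ {order = order} {k} {ord} {rank} {u = u} u∉ refl ranking with refl ← count ranking = record
  { count     = sym (length-++ order)
  ; rank-root = rank-root ranking
  ; entry     = entry′
  }
  where
  entry′ : ∀ {xs v ys} → order ∷ʳ u ≡ xs ++ v ∷ ys →
           (ord [ k ≔ code (suc u) ]) (length xs) ≡ code (suc v) ×
           (rank [ code (suc u) ≔ k + 1 ]) (code (suc v)) ≡ suc (length xs)
  entry′ {xs} eq with split-∷ʳ order xs eq
  ... | inj₁ (refl , refl) = update-same ord k ,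
    trans (update-same rank (code (suc u))) (ℕ.+-comm (length xs) 1)
  ... | inj₂ (ys′ , refl) with ord≡ , rank≡ ← entry ranking {xs} refl =
    trans (update-other ord {k}
      (ℕ.<⇒≢ (subst (length xs <_) (sym (length-++ xs)) (ℕ.m<m+n (length xs) (s≤s z≤n))))) ord≡ ,
    trans (update-other rank {code (suc u)} (λ e →
      u∉ (subst (_∈ order) (Fin.toℕ-injective (ℕ.suc-injective e)) (∈-insert xs)))) rank≡

-- Bucket sort

module _ {G : Graph n} (L : AdjacencyLists G) where
  open Graph G
  open AdjacencyLists L
  open Registers
  open Arrays
  open Program using (bucketSort)

  -- `Represents` in the form in which it is used: for the list splittings that `run-FOR` produces,
  -- and with an arbitrary address `h` because a register equals the code of a node only
  -- propositionally.
  record IsInput (size : ℕ) (start adj : ℕ → ℕ) : Set where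
    field
      size≡   : size ≡ n
      degree≡ : ∀ {u h} → h ≡ code (suc u) → start (h + 1) ∸ start h ≡ deg L u
      adj≡    : ∀ {u vs v ws h} → h ≡ code (suc u) → nbrs u ≡ vs ++ v ∷ ws →
                adj (start h + length vs) ≡ code (suc v)

  represents⇒input : ∀ {s} → Represents nbrs s → IsInput (reg s N) (arr s START) (arr s ADJ)
  represents⇒input {s} rep = record
    { size≡   = size
    ; degree≡ = λ { {u} refl →
      trans (cong (λ h → arr s START h ∸ arr s START (code (suc u))) (ℕ.+-comm (code (suc u)) 1))
                                 (trans (cong (_∸ arr s START (code (suc u))) (next u))
                                   (ℕ.m+n∸m≡n (arr s START (code (suc u))) (deg L u))) }
    ; adj≡    = λ { {u} {vs} refl eq → let j , j≡ , v≡ = lookup-index-++ {vs = vs} eq in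
                    trans (cong (λ i → arr s ADJ (arr s START (code (suc u)) + i)) (sym j≡))
                      (trans (contents u j) (cong (code ∘ suc) v≡)) }
    }
    where open Represents rep

  -- `bucket` is a ghost variable for the lists that the pointers encode. `sizes` is restricted to
  -- `d < n` because only these counters are initialised.
  record IsBuckets (done : List (Fin n)) (bucket : ℕ → List (Fin n)) (head size next : ℕ → ℕ) :
                   Set where
    field
      chain    : ∀ d → Chain next (head d) (bucket d)
      sizes    : ∀ {d} → d < n → size d ≡ length (bucket d)
      sound    : ∀ {d u} → u ∈ bucket d → u ∈ done × deg L u ≡ d
      complete : ∀ {u} → u ∈ done → u ∈ bucket (deg L u)
      unique   : ∀ d → Unique (bucket d)

  open IsBuckets

  buckets-[] : ∀ {head size next} → (∀ {d} → d < n → size d ≡ 0) →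
    IsBuckets [] (const []) head size next
  buckets-[] size≡0 = record
    { chain = λ _ → tt ; sizes = size≡0 ; sound = λ () ; complete = λ () ; unique = λ _ → [] }

  buckets-∷ʳ : ∀ {done bucket head size next u h d} → u ∉ done → h ≡ code (suc u) → d ≡ deg L u →
               IsBuckets done bucket head size next →
               IsBuckets (done ∷ʳ u) (bucket [ d ≔ u ∷ bucket d ])
                 (head [ d ≔ h ]) (size [ d ≔ size d + 1 ]) (next [ h ≔ head d ])
  buckets-∷ʳ {done} {bucket} {head} {size} {next} {u} {h} {d} u∉ refl refl bs = record
    { chain = chain′ ; sizes = sizes′ ; sound = sound′ ; complete = complete′ ; unique = unique′ }
    where
    u∉bucket : ∀ d → u ∉ bucket d
    u∉bucket d = u∉ ∘ proj₁ ∘ sound bs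
    chain′ : ∀ d′ → Chain (next [ h ≔ head d ]) ((head [ d ≔ h ]) d′) ((bucket [ d ≔ u ∷ bucket d ]) d′)
    chain′ d′ with d′ ≡ᵇ d in eq
    ... | true  = refl , subst (λ h′ → Chain (next [ h ≔ head d ]) h′ (bucket d))
      (sym (update-same next h))
                           (chain-update (bucket d) (u∉bucket d) (chain bs d))
    ... | false = chain-update (bucket d′) (u∉bucket d′) (chain bs d′)
    sizes′ : ∀ {d′} → d′ < n → (size [ d ≔ size d + 1 ]) d′ ≡ length ((bucket [ d ≔ u ∷ bucket d ]) d′)
    sizes′ {d′} d′<n with d′ ≡ᵇ d in eq
    ... | true  = trans (ℕ.+-comm (size d) 1) (cong suc (sizes bs (deg<n L u)))
    ... | false = sizes bs d′<n
    sound′ : ∀ {d′ v} → v ∈ (bucket [ d ≔ u ∷ bucket d ]) d′ → v ∈ done ∷ʳ u × deg L v ≡ d′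
    sound′ {d′} v∈ with d′ ≡ᵇ d in eq
    sound′ {d′} (here refl) | true  = ∈-insert done , sym (≡ᵇ-true eq)
    sound′ {d′} (there v∈)  | true  =
      ∈-++⁺ˡ (proj₁ (sound bs v∈)) , trans (proj₂ (sound bs v∈)) (sym (≡ᵇ-true eq))
    sound′ {d′} v∈          | false = Product.map₁ ∈-++⁺ˡ (sound bs v∈)
    complete′ : ∀ {v} → v ∈ done ∷ʳ u → v ∈ (bucket [ d ≔ u ∷ bucket d ]) (deg L v)
    complete′ {v} v∈ with ∈-++⁻ done v∈
    ... | inj₂ (here refl) = subst (v ∈_) (sym (update-same bucket d)) (here refl)
    ... | inj₁ v∈done with deg L v ≡ᵇ d in eq
    ...   | true  = there (subst (λ d′ → v ∈ bucket d′) (≡ᵇ-true eq) (complete bs v∈done))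
    ...   | false = complete bs v∈done
    unique′ : ∀ d′ → Unique ((bucket [ d ≔ u ∷ bucket d ]) d′)
    unique′ d′ with d′ ≡ᵇ d
    ... | true  = All.tabulate (λ { v∈ refl → u∉bucket d v∈ }) ∷ unique bs d
    ... | false = unique bs d′

  module _ {bucket head size next} (bs : IsBuckets (allFin n) bucket head size next) where

    bucket-order : List (Fin n)
    bucket-order = concatMap bucket (downFrom n)

    bucket-order-unique : Unique bucket-order
    bucket-order-unique = Unique.concat⁺ (All.map⁺ (All.universal (unique bs) _))
      (AllPairs.map⁺ (AllPairs.map disjoint (Unique.downFrom⁺ n)))
      where
      disjoint : ∀ {d d′} → d ≢ d′ → Disjoint (bucket d) (bucket d′)
      disjoint d≢d′ (u∈ , u∈′) = d≢d′ (trans (sym (proj₂ (sound bs u∈))) (proj₂ (sound bs u∈′)))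

    bucket-order-↭ : bucket-order ↭ allFin n
    bucket-order-↭ = unique-set⇒↭ bucket-order-unique (Unique.allFin⁺ n)
      (λ {u} → mk⇔ (const (∈-allFin u)) (const (covers u)))
      where
      covers : ∀ u → u ∈ bucket-order
      covers u = ∈-concatMap⁺ bucket
        (Any.map (λ { refl → complete bs (∈-allFin u) }) (∈-downFrom⁺ (deg<n L u)))

    bucket-order-sorted : IsDecreasingDegreeOrder G bucket-order
    bucket-order-sorted = bucket-order-↭ ,
      AllPairs.map (λ {u} {v} le → subst₂ _≤_ (sym (degree≡deg L v)) (sym (degree≡deg L u)) (s≤s le))
        (AllPairs.concat⁺ (All.map⁺ (All.universal within _))
          (AllPairs.map⁺ (AllPairs.map across descending)))
      where
      within : ∀ d → AllPairs (λ u v → deg L v ≤ deg L u) (bucket d)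
      within d = all-pairs-∈ (λ u∈ v∈ →
        ℕ.≤-reflexive (trans (proj₂ (sound bs v∈)) (sym (proj₂ (sound bs u∈)))))
      across : ∀ {d d′} → d′ < d → All (λ u → All (λ v → deg L v ≤ deg L u) (bucket d′)) (bucket d)
      across d′<d = All.tabulate λ u∈ → All.tabulate λ v∈ →
        subst₂ _≤_ (sym (proj₂ (sound bs v∈))) (sym (proj₂ (sound bs u∈))) (ℕ.<⇒≤ d′<d)
      descending : AllPairs (λ d d′ → d′ < d) (downFrom n)
      descending = AllPairs.applyDownFrom⁺₁ id n (λ j<i _ → j<i)

    sum-bucket-lengths : sum (List.map (length ∘ bucket) (downFrom n)) ≡ n
    sum-bucket-lengths = trans (sym (go (downFrom n)))
      (trans (↭-length bucket-order-↭) (length-tabulate id))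
      where
      go : ∀ ds → length (concatMap bucket ds) ≡ sum (List.map (length ∘ bucket) ds)
      go []       = refl
      go (d ∷ ds) = trans (length-++ (bucket d)) (cong (length (bucket d) +_) (go ds))

  size : ℕ
  size = 1 + n + length (edges G)

  open Linear size (s≤s z≤n)

  n≤size : n ≤ size
  n≤size = ℕ.≤-trans (ℕ.n≤1+n n) (ℕ.m≤m+n (suc n) (length (edges G)))

  allFin≤size : length (allFin n) ≤ size
  allFin≤size = subst (_≤ size) (sym (length-tabulate {n = n} id)) n≤size

  Input : Store → Set
  Input s = IsInput (reg s N) (arr s START) (arr s ADJ)

  open IsInput

  nodes-bound : ∀ {k start adj} → IsInput k start adj → k ≡ length (allFin n)
  nodes-bound inp = trans (size≡ inp) (sym (length-tabulate id))

  Filled : List (Fin n) → (ℕ → List (Fin n)) → Store → Set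
  Filled done bucket s = Input s × IsBuckets done bucket (arr s HEAD) (arr s SIZE) (arr s NEXT)

  Sorted : List (Fin n) → Store → Set
  Sorted order s = Input s × IsRanking order (reg s K) (arr s ORDER) (arr s RANK)

  -- The loops of bucketSort.  The numerals below are exact unit costs of their
  -- bodies and the resulting multiples of size.
  private
    clear-buckets : Cmd
    clear-buckets = FOR I < ! N DO (HEAD ⟪ ! I ⟫≔ lit 0 ⨾ SIZE ⟪ ! I ⟫≔ lit 0)

    fill-buckets : Cmd
    fill-buckets =
      FOR I < ! N DO
        ( U ≔ ! I ⊕ lit 1
        ⨾ D ≔ Program.deg (! U)
        ⨾ NEXT ⟪ ! U ⟫≔ HEAD ⟪ ! D ⟫
        ⨾ HEAD ⟪ ! D ⟫≔ ! U
        ⨾ SIZE ⟪ ! D ⟫≔ SIZE ⟪ ! D ⟫ ⊕ lit 1 )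

    collect-bucket : Cmd
    collect-bucket =
      FOR J < SIZE ⟪ ! D ⟫ DO
        ( ORDER ⟪ ! K ⟫≔ ! U
        ⨾ K ≔ ! K ⊕ lit 1
        ⨾ RANK ⟪ ! U ⟫≔ ! K
        ⨾ U ≔ NEXT ⟪ ! U ⟫ )

    collect-buckets : Cmd
    collect-buckets =
      FOR I < ! N DO
        ( D ≔ ! N ⊖ (! I ⊕ lit 1)
        ⨾ U ≔ HEAD ⟪ ! D ⟫
        ⨾ collect-bucket )

  run-clear : ∀ {s} → Input s → LinearRun clear-buckets s (Filled [] (const [])) 9
  run-clear {s} inp = linear-map (λ (inp , size≡0) →
    inp , buckets-[] (λ d<n → size≡0 (∈-allFin (Fin.fromℕ< d<n)) (Fin.toℕ-fromℕ< d<n)))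
    (linear-FOR-const Cleared 6 allFin≤size (nodes-bound inp) (inp , λ ()) clear)
    where
    -- Nodes serve as names of degrees: the round of `u` clears the bucket of degree `toℕ u`.
    Cleared : List (Fin n) → List (Fin n) → Store → Set
    Cleared done _ s = Input s × (∀ {u d} → u ∈ done → toℕ u ≡ d → arr s SIZE d ≡ 0)
    clear : ∀ {done u todo s′} → allFin n ≡ done ++ u ∷ todo → Cleared done (u ∷ todo) s′ →
            Run (HEAD ⟪ ! I ⟫≔ lit 0 ⨾ SIZE ⟪ ! I ⟫≔ lit 0) (setReg I (length done) s′)
              (Cleared (done ∷ʳ u) todo) 6
    clear {done} {u} {todo} {s′} eq (inp , size≡0) = run (inp , size≡0′) ℕ.≤-refl
      where
      size≡0′ : ∀ {v d} → v ∈ done ∷ʳ u → toℕ v ≡ d → (arr s′ SIZE [ length done ≔ 0 ]) d ≡ 0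
      size≡0′ {d = d} v∈ v≡d with d ≡ᵇ length done in d≡ | ∈-++⁻ done v∈
      ... | true  | _                = refl
      ... | false | inj₁ v∈done      = size≡0 v∈done v≡d
      ... | false | inj₂ (here refl) =
        contradiction (trans (sym v≡d) (sym (allFin-index {done = done} eq))) (≡ᵇ-false d≡)

  run-fill : ∀ {s} → Filled [] (const []) s →
    LinearRun fill-buckets s (λ s′ → ∃[ bucket ] Filled (allFin n) bucket s′) 28
  run-fill (inp , bs) = linear-FOR-const (λ done _ s → ∃[ bucket ] Filled done bucket s) 25
    allFin≤size (nodes-bound inp)
    (_ , inp , bs) λ { {done} eq (bucket , inp , bs) → run (_ , inp ,
      buckets-∷ʳ (proj₁ (unique-middle done (subst Unique eq (Unique.allFin⁺ n))))
        (allFin-code {done = done} eq)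
        (degree≡ inp (allFin-code {done = done} eq)) bs) ℕ.≤-refl }

  module _ (bucket : ℕ → List (Fin n)) where

    Collected : List (Fin n) → Store → Set
    Collected done s = Filled (allFin n) bucket s × IsRanking done (reg s K) (arr s ORDER) (arr s RANK)

    -- The invariant carries the rest of the linked list, whose head is the content of `U`.
    -- Uniqueness ensures that no node is ranked twice.
    run-collect-bucket : ∀ {s done} d → d < n → Unique (done ++ bucket d) → reg s D ≡ d →
      Chain (arr s NEXT) (reg s U) (bucket d) →
                         Collected done s → Run collect-bucket s (Collected (done ++ bucket d))
                           (3 + length (bucket d) * 14)
    run-collect-bucket {done = done} _ d<n un refl chain ((inp , bs) , ranking) =
      run-map proj₁ (run-FOR-const (λ us vs s →
        Collected (done ++ us) s × Chain (arr s NEXT) (reg s U) vs) 13 (sizes bs d<n)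
        (((inp , bs) , subst (λ us → IsRanking us _ _ _) (sym (++-identityʳ done)) ranking) , chain)
        λ { {us} {u} {vs} eq (((inp , bs) , ranking) , u≡ , chain) → run
          (((inp , bs) , subst (λ us → IsRanking us _ _ _) (++-assoc done us (u ∷ []))
              (ranking-∷ʳ (proj₁ (unique-middle (done ++ us)
                (subst Unique (trans (cong (done ++_) eq) (sym (++-assoc done us (u ∷ vs)))) un)))
                  u≡ ranking))
            , chain) ℕ.≤-refl })

    run-collect : ∀ {s} → Collected [] s →
      LinearRun collect-buckets s (Collected (concatMap bucket (downFrom n))) 43
    run-collect ((inp , bs) , ranking) =
      -- `12` consists of 6 and 3 for the assignments to `D` and `U` and 3 for entering the inner
      -- loop; `14` is an inner body of 13 with its loop step.
      linear-FOR (λ ds _ s → Collected (concatMap bucket ds) s) (length ∘ bucket) 12 14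
      (subst (_≤ size) (sym (length-downFrom n)) n≤size)
      (ℕ.≤-trans (ℕ.≤-reflexive (sum-bucket-lengths bs)) (ℕ.≤-trans n≤size (ℕ.m≤m+n size _)))
      (trans (size≡ inp) (sym (length-downFrom n))) ((inp , bs) , ranking) collect
      where
      collect : ∀ {ds d ds′ s} → downFrom n ≡ ds ++ d ∷ ds′ → Collected (concatMap bucket ds) s →
                Run (D ≔ ! N ⊖ (! I ⊕ lit 1) ⨾ U ≔ HEAD ⟪ ! D ⟫ ⨾ collect-bucket)
                  (setReg I (length ds) s)
                  (Collected (concatMap bucket (ds ∷ʳ d))) (12 + length (bucket d) * 14)
      collect {ds} {d} {ds′} {s} eq ((inp , bs) , ranking) with d≡ , d<n ← downFrom-index n {ds} eq =
        run-⨾ {P = λ s → Collected (concatMap bucket ds) s × reg s D ≡ d}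
          (run (((inp , bs) , ranking) , trans (cong (_∸ (length ds + 1)) (size≡ inp)) d≡)
            (ℕ.≤-refl {6}))
        λ { (((inp , bs) , ranking) , refl) →
        run-⨾ {P = λ s → Collected (concatMap bucket ds) s × reg s D ≡ d ×
          Chain (arr s NEXT) (reg s U) (bucket d)}
          (run (((inp , bs) , ranking) , refl , chain bs d) (ℕ.≤-refl {3}))
        λ { (col , d≡ , chain) →
        run-map (λ {s} → subst (λ us → Collected us s) (sym snoc))
          (run-collect-bucket d d<n un d≡ chain col) } }
        where
        snoc : concatMap bucket (ds ∷ʳ d) ≡ concatMap bucket ds ++ bucket d
        snoc = trans (concatMap-++ bucket ds (d ∷ []))
          (cong (concatMap bucket ds ++_) (++-identityʳ (bucket d)))
        un : Unique (concatMap bucket ds ++ bucket d)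
        un = unique-prefix (concatMap bucket ds ++ bucket d)
          (subst Unique (trans (cong (concatMap bucket) eq) (trans (concatMap-++ bucket ds (d ∷ ds′))
            (sym (++-assoc (concatMap bucket ds) (bucket d) (concatMap bucket ds′)))))
              (bucket-order-unique bs))

  run-bucketSort : ∀ {s} → Input s →
                   LinearRun bucketSort s (λ s′ →
                     ∃[ order ] IsDecreasingDegreeOrder G order × Sorted order s′) 85
  run-bucketSort inp =
    run-clear inp ⟫ λ filled → run-fill filled ⟫ λ (bucket , filled) →
    linear-const {Q = λ s → Filled (allFin n) bucket s × reg s K ≡ 0}
      (run (filled , refl) (ℕ.≤-refl {2}))
    ⟫ λ (filled , k≡0) →
    linear-const {Q = Collected bucket []}
      (run (filled , record { count = k≡0 ; rank-root = refl ; entry = λ { {[]} () ; {_ ∷ _} () } })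
        (ℕ.≤-refl {3}))
    ⟫ λ collected →
    linear-map (λ ((inp , bs) , ranking) → _ , bucket-order-sorted bs , inp , ranking)
      (run-collect bucket collected)

-- Single steps of the abstract run

open IsRanking

module _ (lg : Log n) (u : Fin n) {v : Fin n} (vs : List (Fin n)) {p : Parents n} where

  scan-processed : suc v ∈ lg → scan lg u (v ∷ vs) p ≡ scan lg u vs p
  scan-processed v∈ with DecMembership._∈?_ Fin._≟_ (suc v) lg
  ... | yes _ = refl
  ... | no v∉ = contradiction v∈ v∉

  scan-success : suc v ∉ lg → p u ≡ p v →
    scan lg u (v ∷ vs) p ≡ scan lg u vs (updateAt p v (const (suc u)))
  scan-success v∉ pu≡pv with DecMembership._∈?_ Fin._≟_ (suc v) lg
  ... | yes v∈ = contradiction v∈ v∉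
  ... | no _ with p u Fin.≟ p v
  ...   | yes _    = refl
  ...   | no pu≢pv = contradiction pu≡pv pu≢pv

  scan-failure : suc v ∉ lg → p u ≢ p v → scan lg u (v ∷ vs) p ≡ failedAt p v
  scan-failure v∉ pu≢pv with DecMembership._∈?_ Fin._≟_ (suc v) lg
  ... | yes v∈ = contradiction v∈ v∉
  ... | no _ with p u Fin.≟ p v
  ...   | yes pu≡pv = contradiction pu≡pv pu≢pv
  ...   | no _      = refl

module _ (nbrs : Fin n → List (Fin n)) {u : Fin n} (us : List (Fin n)) {lg : Log n}
         {p q : Parents n} where

  process-passed : scan lg u (nbrs u) p ≡ passed q →
                   process nbrs (u ∷ us) lg p ≡ process nbrs us (lg ∷ʳ suc u) q
  process-passed eq with scan lg u (nbrs u) p | eq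
  ... | _ | refl = refl

  process-failedAt : ∀ {v} → scan lg u (nbrs u) p ≡ failedAt q v →
    process nbrs (u ∷ us) lg p ≡ failed lg q u v
  process-failedAt eq with scan lg u (nbrs u) p | eq
  ... | _ | refl = refl

-- Ranks and the chronological order

before-++ : ∀ {lg lg′ : Log n} {a b} → ProcessedBefore lg a b → ProcessedBefore (lg ++ lg′) a b
before-++ {lg′ = lg′} (xs , ys , refl , a∈) = xs , ys ++ lg′ , ++-assoc xs (_ ∷ ys) lg′ , a∈

log-++ : ∀ (done todo : List (Fin n)) → log (done ++ todo) ≡ log done ++ List.map suc todo
log-++ done todo = cong (r ∷_) (map-++ suc done todo)

module _ {order : List (Fin n)} (un : Unique order)
         {k : ℕ} {ord rank : ℕ → ℕ} (ranking : IsRanking order k ord rank) where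

  rank-log : ∀ {xs a ys} → log order ≡ xs ++ a ∷ ys → rank (code a) ≡ length xs
  rank-log {xs} {r}     eq with refl , _ ← split-unique [] xs (log-unique un) eq = rank-root ranking
  rank-log {xs} {suc v} eq with ds , es , refl ← ∈-∃++
    (suc∈log⁻ (subst (suc v ∈_) (sym eq) (∈-insert xs)))
    with refl , _ ← split-unique (log ds) xs (subst Unique (log-++ ds (v ∷ es)) (log-unique un))
      (trans (sym (log-++ ds (v ∷ es))) eq) =
    trans (proj₂ (entry ranking refl)) (cong suc (sym (length-map suc ds)))

  before⇒rank< : ∀ {a b} → ProcessedBefore (log order) a b → rank (code a) < rank (code b)
  before⇒rank< {a} {b} (xs , ys , eq , a∈) with as , bs , refl ← ∈-∃++ a∈ =
    subst₂ _<_ (sym (rank-log (trans eq (++-assoc as (a ∷ bs) (b ∷ ys)))))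
      (sym (trans (rank-log eq) (length-++ as)))
      (ℕ.m<m+n (length as) (s≤s z≤n))

  -- Ranks refer to the complete order, `Outputs` to the log at the time of failure, which is an
  -- initial part of it. The converse direction follows from totality, since two distinct entries
  -- cannot precede each other.
  rank<⇔before : ∀ {done todo a b} → order ≡ done ++ todo → a ∈ log done → b ∈ log done → a ≢ b →
                 rank (code a) < rank (code b) ⇔ ProcessedBefore (log done) a b
  rank<⇔before {done} {todo} {a} {b} refl a∈ b∈ a≢b = mk⇔ rank<⇒before (before⇒rank< ∘ extend)
    where
    extend : ∀ {a b} → ProcessedBefore (log done) a b → ProcessedBefore (log order) a b
    extend {a} {b} = subst (λ lg → ProcessedBefore lg a b) (sym (log-++ done todo)) ∘ before-++
    rank<⇒before : rank (code a) < rank (code b) → ProcessedBefore (log done) a b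
    rank<⇒before lt with before-total a∈ b∈ a≢b
    ... | inj₁ bef = bef
    ... | inj₂ bef = contradiction (before⇒rank< (extend bef)) (ℕ.<-asym lt)

  -- `done` is exactly the part of `order` before `u`, so a node other than `u` is processed if and
  -- only if it precedes `u`. This replaces a lookup in the log.
  rank<⇔unprocessed : ∀ {done u todo v} → order ≡ done ++ u ∷ todo → v ∈ order → u ≢ v →
                      rank (code (suc u)) < rank (code (suc v)) ⇔ suc v ∉ log done
  rank<⇔unprocessed {done} {u} {todo} {v} refl v∈ u≢v = mk⇔
    (λ lt v∈done → ℕ.<-asym lt (before⇒rank< (before-log (suc∈log⁻ v∈done)))) later
    where
    later : suc v ∉ log done → rank (code (suc u)) < rank (code (suc v))
    later v∉ with before-total (suc∈log⁺ (∈-insert done)) (suc∈log⁺ v∈) (u≢v ∘ Fin.suc-injective)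
    ... | inj₁ bef = before⇒rank< bef
    ... | inj₂ (xs , ys , eq , v∈xs) with refl , _ ← split-unique (log done) xs
            (subst Unique (log-++ done (u ∷ todo)) (log-unique un))
              (trans (sym (log-++ done (u ∷ todo))) eq) =
      contradiction v∈xs v∉

IsParents : Parents n → (ℕ → ℕ) → Set
IsParents p par = ∀ v → par (code (suc v)) ≡ code (p v)

parents-update : ∀ {p par h h′} {u v : Fin n} → h ≡ code (suc v) → h′ ≡ code (suc u) → IsParents p par →
                 IsParents (updateAt p v (const (suc u))) (par [ h ≔ h′ ])
parents-update {p = p} {par} {u = u} {v} refl refl is w with w Fin.≟ v
... | yes refl = trans (update-same par (code (suc v))) (cong code (sym (updateAt-updates v p)))
... | no w≢v   = trans (update-other par {code (suc v)} (w≢v ∘ Fin.toℕ-injective ∘ ℕ.suc-injective))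
                   (trans (is w) (cong code (sym (updateAt-minimal w v p w≢v))))

-- The main loop of the program

module _ {G : Graph n} (L : AdjacencyLists G) {order} (dec : IsDecreasingDegreeOrder G order) where
  open Graph G
  open AdjacencyLists L
  open Registers
  open Arrays
  open Program using (test-neighbour; processNodes; outputFour)
  open Linear (size L) (s≤s z≤n)
  open IsInput

  private
    un : Unique order
    un = order-unique G L dec

  -- While `scanning`, the rest of the list with the current assignment yields the same result as
  -- the whole scan from `p`. Once `stopped`, that result is known and the remaining rounds are
  -- idle.
  data ScanState (done : List (Fin n)) (u : Fin n) (p : Parents n) (vs : List (Fin n))
                 (f vreg : ℕ) (par : ℕ → ℕ) : Set where
    scanning : ∀ {q} → scan (log done) u vs q ≡ scan (log done) u (nbrs u) p → f ≡ 0 → IsParents q par →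
               ScanState done u p vs f vreg par
    stopped  : ∀ {q v} → scan (log done) u (nbrs u) p ≡ failedAt q v → f ≡ 1 → IsParents q par →
               vreg ≡ code (suc v) → ScanState done u p vs f vreg par

  Scanned : List (Fin n) → Fin n → Parents n → List (Fin n) → Store → Set
  Scanned done u p vs s =
    (Sorted L order s × reg s U ≡ code (suc u)) ×
      ScanState done u p vs (reg s FAILED) (reg s V) (arr s PARENT)

  -- The same simulation one level up, relative to the outcome of the whole run. `halted` also
  -- records `U` and `V`, from which the output starts.
  data RunState (done todo : List (Fin n)) (f ureg vreg : ℕ) (par : ℕ → ℕ) : Set where
    running : ∀ {p} → process nbrs todo (log done) p ≡ recognize nbrs order → f ≡ 0 → IsParents p par →
              RunState done todo f ureg vreg par
    halted  : ∀ {lg p u v} → recognize nbrs order ≡ failed lg p u v → f ≡ 1 → IsParents p par →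
              ureg ≡ code (suc u) → vreg ≡ code (suc v) → RunState done todo f ureg vreg par

  Processed : List (Fin n) → List (Fin n) → Store → Set
  Processed done todo s = Sorted L order s ×
    RunState done todo (reg s FAILED) (reg s U) (reg s V) (arr s PARENT)

  -- The branches mirror the cases of `scan`. The dearest one is the update: 6 for reading `V`, 6
  -- for each of the two tests, 3 for the write.
  run-test-neighbour : ∀ {done u todo p q vs v ws s} → order ≡ done ++ u ∷ todo →
    nbrs u ≡ vs ++ v ∷ ws →
                       Sorted L order s → reg s U ≡ code (suc u) → reg s J ≡ length vs →
                       scan (log done) u (v ∷ ws) q ≡ scan (log done) u (nbrs u) p →
                       reg s FAILED ≡ 0 → IsParents q (arr s PARENT) →
                       Run test-neighbour s (Scanned done u p ws) 21
  run-test-neighbour {done} {u} {todo} {p} {q} {vs} {v} {ws} {s} order≡ nbrs≡ (inp , ranking) u≡ j≡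
    scan≡ f≡0 par =
    run-⨾ {P = λ s → (Sorted L order s × reg s U ≡ code (suc u)) × reg s V ≡ code (suc v) ×
      reg s FAILED ≡ 0 × IsParents q (arr s PARENT)}
      (run (((inp , ranking) , u≡) , trans (cong (λ j → arr s ADJ (arr s START (reg s U) + j)) j≡)
        (adj≡ inp u≡ nbrs≡) , f≡0 , par) (ℕ.≤-refl {6}))
    λ { {s} ((sorted@(inp , ranking) , u≡) , v≡ , f≡0 , par) →
      let unprocessed⇔ = subst₂ (λ a b → arr s RANK a < arr s RANK b ⇔ suc v ∉ log done)
                           (sym u≡) (sym v≡)
                           (rank<⇔unprocessed un ranking order≡ (∈-order G L dec v) u≢v)
          parent-u = trans (cong (arr s PARENT) u≡) (par u)
          parent-v = trans (cong (arr s PARENT) v≡) (par v)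
      in run-IF-≺
        (λ lt → run-IF-==
          (λ eq → run ((sorted , u≡) , scanning
            (trans (sym (scan-success (log done) u ws (to unprocessed⇔ lt)
              (Fin.toℕ-injective (trans (sym parent-u) (trans eq parent-v))))) scan≡)
            f≡0 (parents-update {par = arr s PARENT} v≡ u≡ par)) (ℕ.≤-refl {3}))
          (λ neq → run ((sorted , u≡) , stopped
            (trans (sym scan≡) (scan-failure (log done) u ws (to unprocessed⇔ lt)
              (λ eq → neq (trans parent-u (trans (cong code eq) (sym parent-v))))))
            refl par v≡) (ℕ.n≤1+n 2)))
        (λ ≮ → run ((sorted , u≡) , scanning
          (trans (sym (scan-processed (log done) u ws
            (decidable-stable (DecMembership._∈?_ Fin._≟_ (suc v) (log done))
              (≮ ∘ from unprocessed⇔)))) scan≡) f≡0 par) (s≤s z≤n)) }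
    where
    u≢v : u ≢ v
    u≢v refl = ~-irrefl (nbrs-sound (subst (u ∈_) (sym nbrs≡) (∈-insert vs)))

  run-scan : ∀ {done u todo p s} → order ≡ done ++ u ∷ todo → Scanned done u p (nbrs u) s →
             Run (FOR J < Program.deg (! U) DO IF ! FAILED == lit 0 THEN test-neighbour ELSE SKIP) s
               (Scanned done u p []) (8 + deg L u * 26)
  run-scan {done} {u} {todo} {p} order≡ scanned@(((inp , _) , u≡) , _) =
    run-FOR-const (λ _ → Scanned done u p) 25 (degree≡ inp u≡) scanned step
    where
    step : ∀ {vs v ws s} → nbrs u ≡ vs ++ v ∷ ws → Scanned done u p (v ∷ ws) s →
           Run (IF ! FAILED == lit 0 THEN test-neighbour ELSE SKIP) (setReg J (length vs) s)
             (Scanned done u p ws) 25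
    step {s = s} nbrs≡ ((sorted , u≡) , scanning scan≡ f≡0 par) = run-IF-==
      (λ _ → run-test-neighbour order≡ nbrs≡ sorted u≡ refl scan≡ f≡0 par)
      (λ f≢0 → contradiction f≡0 f≢0)
    step {s = s} nbrs≡ ((sorted , u≡) , stopped scan≡ f≡1 par v≡) = run-IF-==
      (λ f≡0 → contradiction (trans (sym f≡0) f≡1) λ ())
      (λ _ → run ((sorted , u≡) , stopped scan≡ f≡1 par v≡) (s≤s z≤n))

  private
    process-node : Cmd
    process-node =
      IF ! FAILED == lit 0
        THEN ( U ≔ ORDER ⟪ ! I ⟫
             ⨾ FOR J < Program.deg (! U) DO
                 IF ! FAILED == lit 0 THEN test-neighbour ELSE SKIP )
        ELSE SKIP

  -- `15` is 4 for the guard, 3 for reading `ORDER` and 8 for entering the scan loop; a neighbour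
  -- costs 25 and a loop step.
  run-process-node : ∀ {done u todo s} → order ≡ done ++ u ∷ todo → Processed done (u ∷ todo) s →
                     Run process-node (setReg I (length done) s) (Processed (done ∷ʳ u) todo)
                       (15 + deg L u * 26)
  run-process-node {done} {u} {todo} {s} order≡
    (sorted@(_ , ranking) , running {p} process≡ f≡0 par) = run-IF-==
    (λ _ → run-⨾ {P = Scanned done u p (nbrs u)}
      (run ((sorted , proj₁ (entry ranking order≡)) , scanning refl f≡0 par) (ℕ.≤-refl {3}))
      λ {s} scanned → run-map (λ {s} → finish {s}) (run-scan {s = s} order≡ scanned))
    (λ f≢0 → contradiction f≡0 f≢0)
    where
    finish : ∀ {s} → Scanned done u p [] s → Processed (done ∷ʳ u) todo s
    finish ((sorted , u≡) , scanning {q} scan≡ f≡0 par) = sorted ,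
      running (trans (cong (λ lg → process nbrs todo lg q) (sym (log-∷ʳ done u)))
        (trans (sym (process-passed nbrs todo (sym scan≡))) process≡)) f≡0 par
    finish ((sorted , u≡) , stopped scan≡ f≡1 par v≡) = sorted ,
      halted (trans (sym process≡) (process-failedAt nbrs todo scan≡)) f≡1 par u≡ v≡
  run-process-node {done} {u} order≡ (sorted , halted out≡ f≡1 par u≡ v≡) = run-IF-==
    (λ f≡0 → contradiction (trans (sym f≡0) f≡1) λ ())
    (λ _ → run (sorted , halted out≡ f≡1 par u≡ v≡) (s≤s z≤n))

  run-processNodes : ∀ {s} → Sorted L order s → LinearRun processNodes s (Processed order []) 80
  run-processNodes sorted@(inp , _) =
    linear-FOR-const Cleared 5 (allFin≤size L) (nodes-bound L inp) (sorted , λ ()) clear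
    ⟫ λ (sorted , par≡0) →
    linear-const {Q = λ s → Processed [] order s}
      (run (sorted , running refl refl (λ v → par≡0 (∈-allFin v))) (ℕ.≤-refl {2}))
    ⟫ λ { processed@((inp , _) , _) →
    linear-FOR Processed (deg L) 15 26 order≤size sum-order (trans (size≡ inp) (sym length-order))
      processed run-process-node }
    where
    Cleared : List (Fin n) → List (Fin n) → Store → Set
    Cleared done _ s = Sorted L order s × (∀ {v} → v ∈ done → arr s PARENT (code (suc v)) ≡ 0)
    clear : ∀ {done u todo s} → allFin n ≡ done ++ u ∷ todo → Cleared done (u ∷ todo) s →
            Run (PARENT ⟪ ! I ⊕ lit 1 ⟫≔ lit 0) (setReg I (length done) s) (Cleared (done ∷ʳ u) todo) 5
    clear {done} {u} {s = s} eq (sorted , par≡0) = run (sorted , par≡0′) ℕ.≤-refl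
      where
      par≡0′ : ∀ {v} → v ∈ done ∷ʳ u → (arr s PARENT [ length done + 1 ≔ 0 ]) (code (suc v)) ≡ 0
      par≡0′ {v} v∈ with code (suc v) ≡ᵇ length done + 1 in v≡ | ∈-++⁻ done v∈
      ... | true  | _                = refl
      ... | false | inj₁ v∈done      = par≡0 v∈done
      ... | false | inj₂ (here refl) = contradiction (sym (allFin-code {done = done} eq)) (≡ᵇ-false v≡)
    length-order : length order ≡ n
    length-order = trans (↭-length (proj₁ dec)) (length-tabulate id)
    order≤size : length order ≤ size L
    order≤size = subst (_≤ size L) (sym length-order) (n≤size L)
    -- `order` permutes the nodes, so all scan loops together take at most two rounds per edge.
    sum-order : sum (List.map (deg L) order) ≤ 2 * size L
    sum-order = subst (_≤ 2 * size L) (sym (sum-↭ (map⁺ (deg L) (proj₁ dec))))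
      (ℕ.≤-trans (sum-deg≤2edges L) (ℕ.*-monoʳ-≤ 2 (ℕ.m≤n+m (length (edges G)) (1 + n))))

  -- The search for the fourth node

  record IsMarking (marked : List (Fin n)) (mark : ℕ → ℕ) : Set where
    field
      mark≡1 : ∀ {x} → x ∈ marked → mark (code (suc x)) ≡ 1
      mark≡0 : ∀ {x} → x ∉ marked → mark (code (suc x)) ≡ 0

  open IsMarking

  marking-∷ʳ : ∀ {marked mark h x} → h ≡ code (suc x) → IsMarking marked mark →
               IsMarking (marked ∷ʳ x) (mark [ h ≔ 1 ])
  marking-∷ʳ {marked} {mark} {x = x} refl is = record { mark≡1 = mark≡1′ ; mark≡0 = mark≡0′ }
    where
    mark≡1′ : ∀ {y} → y ∈ marked ∷ʳ x → (mark [ code (suc x) ≔ 1 ]) (code (suc y)) ≡ 1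
    mark≡1′ {y} y∈ with code (suc y) ≡ᵇ code (suc x) in y≡ | ∈-++⁻ marked y∈
    ... | true  | _                = refl
    ... | false | inj₁ y∈marked    = mark≡1 is y∈marked
    ... | false | inj₂ (here refl) = contradiction refl (≡ᵇ-false {code (suc x)} y≡)
    mark≡0′ : ∀ {y} → y ∉ marked ∷ʳ x → (mark [ code (suc x) ≔ 1 ]) (code (suc y)) ≡ 0
    mark≡0′ {y} y∉ = trans (update-other mark {code (suc x)}
        (λ e → y∉ (subst (_∈ marked ∷ʳ x) (Fin.toℕ-injective (ℕ.suc-injective (sym e)))
          (∈-insert marked))))
      (mark≡0 is (y∉ ∘ ∈-++⁺ˡ))

  deg≤size : ∀ u → deg L u ≤ size L
  deg≤size u = ℕ.≤-trans (ℕ.<⇒≤ (deg<n L u)) (n≤size L)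

  private
    find-fourth : Cmd
    find-fourth =
      FOR I < ! N DO (MARK ⟪ ! I ⊕ lit 1 ⟫≔ lit 0)
      ⨾ MARK ⟪ ! U ⟫≔ lit 1
      ⨾ FOR J < Program.deg (! U) DO (MARK ⟪ ADJ ⟪ START ⟪ ! U ⟫ ⊕ ! J ⟫ ⟫≔ lit 1)
      ⨾ FOR J < Program.deg (! W) DO
        ( Y ≔ ADJ ⟪ START ⟪ ! W ⟫ ⊕ ! J ⟫
        ⨾ IF MARK ⟪ ! Y ⟫ == lit 0 THEN X ≔ ! Y ELSE SKIP )
      ⨾ OUT ⟪ lit 0 ⟫≔ ! V
      ⨾ OUT ⟪ lit 1 ⟫≔ ! U
      ⨾ OUT ⟪ lit 2 ⟫≔ ! W
      ⨾ OUT ⟪ lit 3 ⟫≔ ! X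

  module _ {done p a b} (wait-a : Waiting G done p a) (wait-b : Waiting G done p b) (a~b : a ~ b)
           (bef : ProcessedBefore (log done) (p b) (p a)) {w} (pa≡w : p a ≡ suc w) where

    private
      Four : Store → Set
      Four s = Input L s × reg s FAILED ≡ 1 × reg s U ≡ code (suc a) × reg s V ≡ code (suc b) ×
        reg s W ≡ code (suc w)

      -- `X` starts with an arbitrary value and keeps the last hit. The second alternative describes
      -- a search without a hit so far: all neighbours seen are marked.
      Found : List (Fin n) → ℕ → Set
      Found vs x = (∃[ y ] x ≡ code (suc y) × y ∉ a ∷ nbrs a × w ~ y) ⊎
        (∀ {y} → y ∈ vs → y ∈ a ∷ nbrs a)

      Reported : Store → Set
      Reported s = reg s FAILED ≡ 1 × ∃[ q ] Finds G (log done) p a b q ×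
        (∀ i → arr s OUT (toℕ i) ≡ code (lookup q i))

      -- A search that ends without a hit would have all neighbours of `w` marked, contrary to
      -- `fourth-node`, whose `x` lies in the list of `w` because it is not `r`.
      found-node : ∀ {x} → Found (nbrs w) x → ∃[ y ] x ≡ code (suc y) × y ∉ a ∷ nbrs a × w ~ y
      found-node (inj₁ found) = found
      found-node (inj₂ all∈) with fourth-node G wait-a wait-b a~b bef
      ... | r     , _   , _   , a≁x = contradiction tt a≁x
      ... | suc x , x≢a , w~x , a≁x
        with all∈ (nbrs-complete (subst (λ y → Adj (withRoot G) y (suc x)) pa≡w w~x))
      ...   | here refl = contradiction refl x≢a
      ...   | there x∈  = contradiction (nbrs-sound x∈) a≁x

      report : ∀ {s} → Four s × Found (nbrs w) (reg s X) →
               LinearRun (OUT ⟪ lit 0 ⟫≔ ! V ⨾ OUT ⟪ lit 1 ⟫≔ ! U ⨾ OUT ⟪ lit 2 ⟫≔ ! W ⨾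
                 OUT ⟪ lit 3 ⟫≔ ! X) s Reported 12
      report ((_ , f≡1 , u≡ , v≡ , w≡) , found) with y , x≡ , y∉ , w~y ← found-node found = linear-const
        (run (f≡1 , _ , finds bef (λ { refl → y∉ (here refl) })
          (subst (λ z → Adj (withRoot G) z (suc y)) (sym pa≡w) w~y) (y∉ ∘ there ∘ nbrs-complete) ,
              λ { 0F → v≡ ; 1F → u≡ ; 2F → trans w≡ (cong code (sym pa≡w)) ; 3F → x≡ }) ℕ.≤-refl)

      unmark : ∀ {vs v ws s} → allFin n ≡ vs ++ v ∷ ws →
        Four s × (∀ {x} → x ∈ vs → arr s MARK (code (suc x)) ≡ 0) →
               Run (MARK ⟪ ! I ⊕ lit 1 ⟫≔ lit 0) (setReg I (length vs) s)
                 (λ s → Four s × (∀ {x} → x ∈ vs ∷ʳ v → arr s MARK (code (suc x)) ≡ 0)) 5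
      unmark {vs} {v} {ws} {s} eq (four , ≡0) = run (four , ≡0′) ℕ.≤-refl
        where
        ≡0′ : ∀ {x} → x ∈ vs ∷ʳ v → (arr s MARK [ length vs + 1 ≔ 0 ]) (code (suc x)) ≡ 0
        ≡0′ {x} x∈ with code (suc x) ≡ᵇ length vs + 1 in x≡ | ∈-++⁻ vs x∈
        ... | true  | _                = refl
        ... | false | inj₁ x∈vs        = ≡0 x∈vs
        ... | false | inj₂ (here refl) = contradiction (sym (allFin-code {done = vs} eq)) (≡ᵇ-false x≡)

      mark : ∀ {vs v ws s} → nbrs a ≡ vs ++ v ∷ ws → Four s × IsMarking (a ∷ vs) (arr s MARK) →
             Run (MARK ⟪ ADJ ⟪ START ⟪ ! U ⟫ ⊕ ! J ⟫ ⟫≔ lit 1) (setReg J (length vs) s)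
               (λ s → Four s × IsMarking (a ∷ (vs ∷ʳ v)) (arr s MARK)) 7
      mark eq (four@(inp , _ , u≡ , _) , is) = run (four , marking-∷ʳ (adj≡ inp u≡ eq) is) ℕ.≤-refl

      look : ∀ {vs v ws s} → nbrs w ≡ vs ++ v ∷ ws →
        (Four s × IsMarking (a ∷ nbrs a) (arr s MARK)) × Found vs (reg s X) →
             Run (Y ≔ ADJ ⟪ START ⟪ ! W ⟫ ⊕ ! J ⟫ ⨾ IF MARK ⟪ ! Y ⟫ == lit 0 THEN X ≔ ! Y ELSE SKIP)
               (setReg J (length vs) s)
               (λ s → (Four s × IsMarking (a ∷ nbrs a) (arr s MARK)) × Found (vs ∷ʳ v) (reg s X)) 13
      look {vs} {v} {ws} eq ((four@(inp , _ , _ , _ , w≡) , is) , found) =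
        run-⨾ {P = λ s → (Four s × IsMarking (a ∷ nbrs a) (arr s MARK)) × Found vs (reg s X) ×
          reg s Y ≡ code (suc v)}
          (run ((four , is) , found , adj≡ inp w≡ eq) (ℕ.≤-refl {6}))
        λ { {s} ((four , is) , found , y≡) → run-IF-==
          (λ mark≡ → run ((four , is) , inj₁ (v , y≡ ,
              (λ v∈ → contradiction (trans (sym (mark≡1 is v∈))
                (trans (sym (cong (arr s MARK) y≡)) mark≡)) λ ()) ,
              nbrs-sound (subst (v ∈_) (sym eq) (∈-insert vs)))) (ℕ.≤-refl {2}))
          (λ mark≢ → run ((four , is) ,
            extend found (decidable-stable (DecMembership._∈?_ Fin._≟_ v (a ∷ nbrs a))
              λ v∉ → mark≢ (trans (cong (arr s MARK) y≡) (mark≡0 is v∉)))) (s≤s z≤n)) }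
        where
        extend : ∀ {x} → Found vs x → v ∈ a ∷ nbrs a → Found (vs ∷ʳ v) x
        extend (inj₁ found) v∈ = inj₁ found
        extend (inj₂ all∈)  v∈ = inj₂ λ y∈ → case y∈
          where
          case : ∀ {y} → y ∈ vs ∷ʳ v → y ∈ a ∷ nbrs a
          case y∈ with ∈-++⁻ vs y∈
          ... | inj₁ y∈vs        = all∈ y∈vs
          ... | inj₂ (here refl) = v∈

    run-find-fourth : ∀ {s} → Four s → LinearRun find-fourth s Reported 61
    run-find-fourth four@(inp , _) =
      linear-FOR-const (λ vs _ s → Four s × (∀ {x} → x ∈ vs → arr s MARK (code (suc x)) ≡ 0)) 5
        (allFin≤size L) (nodes-bound L inp) (four , λ ()) unmark
      ⟫ λ { {s} (four@(_ , _ , u≡ , _) , ≡0) →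
      linear-const {Q = λ s → Four s × IsMarking (a ∷ []) (arr s MARK)}
        -- The cleared array marks the empty list. Marking `a` itself first is what enforces that
        -- `x` differs from `a`.
        (run (four , marking-∷ʳ {marked = []} {arr s MARK} u≡
          (record { mark≡1 = λ () ; mark≡0 = λ _ → ≡0 (∈-allFin _) })) (ℕ.≤-refl {3}))
      ⟫ λ { (four@(inp , _ , u≡ , _) , is) →
      linear-FOR-const (λ vs _ s → Four s × IsMarking (a ∷ vs) (arr s MARK)) 7
        (deg≤size a) (degree≡ inp u≡) (four , is) mark
      ⟫ λ { (four@(inp , _ , _ , _ , w≡) , is) →
      linear-FOR-const (λ vs _ s →
        (Four s × IsMarking (a ∷ nbrs a) (arr s MARK)) × Found vs (reg s X)) 13
        (deg≤size w) (degree≡ inp w≡) ((four , is) , inj₂ λ ()) look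
      ⟫ λ { ((four , _) , found) → report (four , found) } } } }

  run-outputFour : ∀ {s lg p u v} → Sorted L order s → recognize nbrs order ≡ failed lg p u v →
    reg s FAILED ≡ 1 →
                   IsParents p (arr s PARENT) → reg s U ≡ code (suc u) → reg s V ≡ code (suc v) →
                   LinearRun outputFour s (Reports G (failed lg p u v)) 78
  run-outputFour {s} {lg} {p} {u} {v} (inp , ranking) out≡ f≡1 par u≡ v≡ =
    linear-const {Q = Oriented} (run-IF-≺
      (λ lt → run ((inp , f≡1 , par) , u , v , inj₁ ∘ subst-log , wait-u , wait-v , u~v ,
        to before⇔ lt , u≡ , v≡) (s≤s z≤n))
      (λ ≮ → run ((inp , f≡1 , par) , v , u , inj₂ ∘ subst-log , wait-v , wait-u , ~-sym u~v ,
        not-before (≮ ∘ from before⇔) , v≡ , u≡) (ℕ.≤-refl {6})))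
    ⟫ λ { {s} ((inp , f≡1 , par) , a , b , out , wait-a , wait-b , a~b , bef , u≡ , v≡) →
    let w , pa≡w , _ = before⇒nonroot bef in
    linear-const {Q = λ s → Input L s × reg s FAILED ≡ 1 × reg s U ≡ code (suc a) ×
      reg s V ≡ code (suc b) × reg s W ≡ code (suc w)}
      (run (inp , f≡1 , u≡ , v≡ , trans (cong (arr s PARENT) u≡) (trans (par a) (cong code pa≡w)))
        (ℕ.≤-refl {3}))
    ⟫ λ four →
    linear-map (λ (f≡1 , q , found , eqs) → f≡1 , q , out found , eqs)
      (run-find-fourth wait-a wait-b a~b bef pa≡w four) }
    where
    conflict : Conflict G L order lg p u v
    conflict = recognize-failed G L dec out≡
    open Conflict conflict
    wait-u : Waiting G done p u
    wait-u = conflict-u G L dec conflict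
    wait-v : Waiting G done p v
    wait-v = conflict-v G L dec conflict
    -- After the conditional exchange `U` holds the end `a` whose parent was processed later, so one
    -- search serves both cases; the function into `Outputs` remembers which case it was.
    Oriented : Store → Set
    Oriented s = (Input L s × reg s FAILED ≡ 1 × IsParents p (arr s PARENT)) × ∃₂ λ a b →
      (∀ {q} → Finds G (log done) p a b q → Outputs G lg p u v q) ×
      Waiting G done p a × Waiting G done p b × a ~ b × ProcessedBefore (log done) (p b) (p a) ×
      reg s U ≡ code (suc a) × reg s V ≡ code (suc b)
    subst-log : ∀ {a b q} → Finds G (log done) p a b q → Finds G lg p a b q
    subst-log {a} {b} {q} = subst (λ lg → Finds G lg p a b q) (sym log≡)
    before⇔ : arr s RANK (arr s PARENT (reg s V)) < arr s RANK (arr s PARENT (reg s U)) ⇔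
      ProcessedBefore (log done) (p v) (p u)
    before⇔ = subst₂ (λ k l → arr s RANK k < arr s RANK l ⇔ ProcessedBefore (log done) (p v) (p u))
      (sym (trans (cong (arr s PARENT) v≡) (par v))) (sym (trans (cong (arr s PARENT) u≡) (par u)))
      (rank<⇔before un ranking order≡ (Waiting.parent∈ wait-v) (Waiting.parent∈ wait-u) (≢-sym pu≢pv))
    not-before : ¬ ProcessedBefore (log done) (p v) (p u) → ProcessedBefore (log done) (p u) (p v)
    not-before ¬bef with before-total (Waiting.parent∈ wait-u) (Waiting.parent∈ wait-v) pu≢pv
    ... | inj₁ bef = bef
    ... | inj₂ bef = contradiction bef ¬bef

  run-report : ∀ {s} → Processed order [] s →
               LinearRun (IF ! FAILED == lit 0 THEN SKIP ELSE outputFour) s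
                 (Reports G (recognize nbrs order)) 82
  run-report {s} (sorted , running {p} out≡ f≡0 par) = linear-IF-==
    (λ _ → linear-const (run (subst (λ o → Reports G o s) out≡ (f≡0 , par)) (s≤s z≤n)))
    (λ f≢0 → contradiction f≡0 f≢0)
  run-report (sorted , halted out≡ f≡1 par u≡ v≡) = linear-IF-==
    (λ f≡0 → contradiction (trans (sym f≡0) f≡1) λ ())
    (λ _ → linear-map (λ {s} → subst (λ o → Reports G o s) (sym out≡))
      (run-outputFour sorted out≡ f≡1 par u≡ v≡))

-- The whole program

module _ {G : Graph n} (L : AdjacencyLists G) where
  open AdjacencyLists L
  open Linear (size L) (s≤s z≤n)

  -- The order is the one that the buckets happen to produce; the later phases work for any valid
  -- order stored in `ORDER` and `RANK`. `247` is 85 for sorting, 80 for the main loop and 82 for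
  -- the report.
  run-recognize : ∀ {s} → Represents nbrs s →
                  LinearRun recognizeProgram s
                    (λ s′ → ∃[ order ] IsDecreasingDegreeOrder G order ×
                      Reports G (recognize nbrs order) s′) 247
  run-recognize rep =
    run-bucketSort L (represents⇒input L rep) ⟫ λ (order , dec , sorted) →
    linear-map (λ reports → order , dec , reports) (run-processNodes L dec sorted ⟫ run-report L dec)

mainTheorem1 : (∀ {n} (G : Graph n) (L : AdjacencyLists G) (order : List (Fin n)) →
    IsDecreasingDegreeOrder G order →
    (∀ p → recognize (AdjacencyLists.nbrs L) order ≡ completed p →
    IsQuasiThreshold G × IsSkeleton G p)
    ×
    (∀ log p u v → recognize (AdjacencyLists.nbrs L) order ≡ failed log p u v →
    (∃[ q ] Outputs G log p u v q)
    × (∀ q → Outputs G log p u v q →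
    ∃[ nodes ] q ≡ map suc nodes × (Induces G nodes P₄ ⊎ Induces G nodes C₄))
    × ¬ IsQuasiThreshold G))
    ×
    (∃[ c ] ∀ {n} (G : Graph n) (L : AdjacencyLists G) (s : Store) →
    Represents (AdjacencyLists.nbrs L) s →
    (∃[ order ] IsDecreasingDegreeOrder G order
    × Reports G (recognize (AdjacencyLists.nbrs L) order) (exec recognizeProgram s))
    × time recognizeProgram s ≤ c * (1 + n + length (edges G)))
mainTheorem1 =
  (λ G L order dec →
    (λ p eq → let skeleton = recognize-completed G L dec eq in
      skeleton⇒quasi-threshold G skeleton , skeleton) ,
    λ lg p u v eq → let conflict = recognize-failed G L dec eq in
      conflict-outputs G L dec conflict ,
      (λ q → outputs⇒induces G L dec conflict) ,
      conflict⇒¬quasi-threshold G L dec conflict) ,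
  247 , λ G L s rep → let run post cost = Linear.linear-run (run-recognize L rep) in post , cost
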